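{- Let $a\in\{0,1\}$ and let $M$ be a nonnegative integer. Then \[ \sum_{\substack{r\ge0,\\ r\equiv a \bmod 2}} q^{r^2} \frac{(q^2;q^2)_M}{(q^2;q^2)_r(q)_{M-r}} = \sum_{j\in\mathbb Z} q^{24j^2+2j(1-6\delta_{a,1})+\delta_{a,1}} \begin{bmatrix}2M\\ M-6j+a\end{bmatrix}_{q} - \sum_{j\in\mathbb Z} q^{24j^2-2j(7+6\delta_{a,1})+2+5\delta_{a,1}} \begin{bmatrix}2M\\ M-6j+a+2\end{bmatrix}_{q}, \] where $\delta_{a,1}$ is the Kronecker delta.
   Context: The Gaussian binomial $\begin{bmatrix}A\\ B\end{bmatrix}_q$ equals $\frac{(q)_{A}}{(q)_B(q)_{A-B}}$ if $B$ and $A-B$ are nonnegative integers and $0$ otherwise, where $(q)_n=\prod_{j=1}^n(1-q^j)$ and $1/(q)_n:=0$ for $n<0$. For $n\ge0$, $(a;q)_n=\prod_{j=0}^{n-1}(1-aq^j)$. -}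

module Defs where

open import Data.Nat as ℕ using (ℕ; zero; suc; _≡ᵇ_; _%_)
open import Data.Integer as ℤ using (ℤ; +_; -[1+_])
open import Data.Rational using (ℚ; 0ℚ; 1ℚ; _+_; _*_; _-_; 1/_; ≢-nonZero)
open import Data.Rational.Properties using (_≟_)
open import Data.Bool using (if_then_else_)
open import Relation.Nullary using (yes; no)

_^ℕ_ : ℚ → ℕ → ℚ
x ^ℕ zero = 1ℚ
x ^ℕ suc n = x * (x ^ℕ n)

-- total reciprocal (1/0 := 0); only ever applied to nonzero values below
inv : ℚ → ℚ
inv x with x ≟ 0ℚ
... | yes _ = 0ℚ
... | no x≢0 = 1/_ x {{≢-nonZero x≢0}}

_^ℤ_ : ℚ → ℤ → ℚ
x ^ℤ (+ n) = x ^ℕ n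
x ^ℤ -[1+ n ] = inv (x ^ℕ suc n)

poch : ℚ → ℚ → ℕ → ℚ
poch a q zero = 1ℚ
poch a q (suc n) = poch a q n * (1ℚ - a * (q ^ℕ n))

qpoch : ℚ → ℕ → ℚ
qpoch q n = poch q q n

-- 1/(q)_n for integer n, with 1/(q)_n := 0 for n < 0
recipQPoch : ℚ → ℤ → ℚ
recipQPoch q (+ n) = inv (qpoch q n)
recipQPoch q -[1+ n ] = 0ℚ

-- Gaussian binomial [A ; B]_q : (q)_A/((q)_B (q)_{A-B}) if B, A-B ≥ 0, else 0
gauss : ℚ → ℤ → ℤ → ℚ
gauss q (+ A) (+ B) with ℤ.+ A ℤ.- ℤ.+ B
... | + C = qpoch q A * inv (qpoch q B * qpoch q C)
... | -[1+ _ ] = 0ℚ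
gauss q _ _ = 0ℚ

δ : ℕ → ℕ → ℕ
δ a b = if a ≡ᵇ b then 1 else 0

sumBelow : ℕ → (ℕ → ℚ) → ℚ
sumBelow zero f = 0ℚ
sumBelow (suc N) f = sumBelow N f + f N

sumSym : ℕ → (ℤ → ℚ) → ℚ
sumSym zero f = f (+ 0)
sumSym (suc N) f = sumSym N f + f (+ suc N) + f -[1+ N ]

lhsTerm : ℚ → ℕ → ℕ → ℕ → ℚ
lhsTerm q a M r =
  if (r % 2) ≡ᵇ a
  then (q ^ℕ (r ℕ.* r)) * poch (q * q) (q * q) M * inv (poch (q * q) (q * q) r)
         * recipQPoch q (+ M ℤ.- + r)
  else 0ℚ

rhsTerm₁ : ℚ → ℕ → ℕ → ℤ → ℚ
rhsTerm₁ q a M j =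
  (q ^ℤ (+ 24 ℤ.* j ℤ.* j ℤ.+ + 2 ℤ.* j ℤ.* (+ 1 ℤ.- + 6 ℤ.* + δ a 1) ℤ.+ + δ a 1))
  * gauss q (+ (2 ℕ.* M)) (+ M ℤ.- + 6 ℤ.* j ℤ.+ + a)

rhsTerm₂ : ℚ → ℕ → ℕ → ℤ → ℚ
rhsTerm₂ q a M j =
  (q ^ℤ (+ 24 ℤ.* j ℤ.* j ℤ.- + 2 ℤ.* j ℤ.* (+ 7 ℤ.+ + 6 ℤ.* + δ a 1) ℤ.+ + 2 ℤ.+ + 5 ℤ.* + δ a 1))
  * gauss q (+ (2 ℕ.* M)) (+ M ℤ.- + 6 ℤ.* j ℤ.+ + a ℤ.+ + 2)

-- Write F M w = Σ_r w^r q^{r²} [M, r]_{q²} (-q; q)_{M-r}.  The left-hand sides for a = 0 and a = 1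
-- add up to F M 1 and subtract to F M (-1).  Applying both Pascal rules to [M + 1, r + 1]_{q²} gives
-- F (M + 1) w = F M w + (1 + w) q^{M+1} F M (wq) together with a companion recurrence expressing
-- F (M + 1) q through F M q and F M 1; hence F M (-1) = 1, and (F M 1, F M q) is pinned down by its
-- value at M = 0.  On the right, t = -2j and t = 2j - 1 (after reflecting the binomials of the
-- subtracted sum) turn the sum and the difference over a into Σ_t σ^t (θ₀ t + ε θ₁ t) with
-- (σ, ε) = (-1, 1) resp. (1, -1), θ₀ t = q^{6t²-t} [2M, M+3t]_q, θ₁ t = q^{6t²+5t+1} [2M, M+3t+1]_q.
-- Pascal's rules applied termwise to these bilateral sums, through auxiliary sums of binomials of
-- order 2M + 1, reproduce the same recurrences.  The base q = 0, where integer powers are not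
-- multiplicative, is computed directly.

module Submission where

open import Data.Nat as ℕ using (ℕ; zero; suc; _%_)
import Data.Nat.Properties as ℕP
import Data.Nat.DivMod as ℕD
import Data.Nat.Tactic.RingSolver as NS
open import Data.Integer as ℤ using (ℤ; +_; -[1+_]; _⊖_)
import Data.Integer.Properties as ℤP
import Data.Integer.Tactic.RingSolver as ZS
open import Data.Rational
open import Data.Rational.Properties
open import Algebra.Bundles using (CommutativeMonoid)
open import Algebra.Properties.Group +-0-group using (x∙y⁻¹≈ε⇒x≈y; ⁻¹-involutive)
open import Algebra.Properties.CommutativeSemigroup (CommutativeMonoid.commutativeSemigroup *-1-commutativeMonoid)
  using (x∙yz≈y∙xz; xy∙z≈y∙xz) renaming (interchange to *-interchange)
open import Data.Product using (_×_; _,_; ∃-syntax; proj₁)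
open import Data.Sum using (_⊎_; inj₁; inj₂)
open import Data.Empty using (⊥-elim)
open import Data.Maybe using (Maybe; just; nothing)
open import Data.Bool using (if_then_else_)
open import Function using (_∘_)
open import Level using (0ℓ)
open import Relation.Nullary using (yes; no)
open import Relation.Binary.Definitions using (tri<; tri≈; tri>)
open import Relation.Binary.PropositionalEquality
import Tactic.RingSolver as Solver
import Tactic.RingSolver.Core.AlmostCommutativeRing as ACR
open import Defs

ℚ-ring : ACR.AlmostCommutativeRing 0ℓ 0ℓ
ℚ-ring = ACR.fromCommutativeRing +-*-commutativeRing isZero
  where
  isZero : ∀ x → Maybe (0ℚ ≡ x)
  isZero x with x ≟ 0ℚ
  ... | yes x≡0 = just (sym x≡0)
  ... | no _    = nothing

cong₃ : ∀ {A B C D : Set} (f : A → B → C → D) {a a′ b b′ c c′} →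
        a ≡ a′ → b ≡ b′ → c ≡ c′ → f a b c ≡ f a′ b′ c′
cong₃ f refl refl refl = refl

cong₄ : ∀ {A B C D E : Set} (f : A → B → C → D → E) {a a′ b b′ c c′ d d′} →
        a ≡ a′ → b ≡ b′ → c ≡ c′ → d ≡ d′ → f a b c d ≡ f a′ b′ c′ d′
cong₄ f refl refl refl refl = refl

inv-inverseʳ : ∀ x → x ≢ 0ℚ → x * inv x ≡ 1ℚ
inv-inverseʳ x x≢0 with x ≟ 0ℚ
... | yes x≡0 = ⊥-elim (x≢0 x≡0)
... | no x≢0′ = *-inverseʳ x {{≢-nonZero x≢0′}}

*-cancelʳ-≢0 : ∀ a b c → c ≢ 0ℚ → a * c ≡ b * c → a ≡ b
*-cancelʳ-≢0 a b c c≢0 ac≡bc = begin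
  a                ≡⟨ undo a ⟩
  a * c * inv c    ≡⟨ cong (_* inv c) ac≡bc ⟩
  b * c * inv c    ≡⟨ sym (undo b) ⟩
  b                ∎
  where
  open ≡-Reasoning
  undo : ∀ x → x ≡ x * c * inv c
  undo x = begin
    x                ≡⟨ sym (*-identityʳ x) ⟩
    x * 1ℚ           ≡⟨ cong (x *_) (sym (inv-inverseʳ c c≢0)) ⟩
    x * (c * inv c)  ≡⟨ sym (*-assoc x c (inv c)) ⟩
    x * c * inv c    ∎

*-≢0 : ∀ x y → x ≢ 0ℚ → y ≢ 0ℚ → x * y ≢ 0ℚ
*-≢0 x y x≢0 y≢0 xy≡0 = x≢0 (*-cancelʳ-≢0 x 0ℚ y y≢0 (trans xy≡0 (sym (*-zeroˡ y))))

inv-unique : ∀ x y → x * y ≡ 1ℚ → inv x ≡ y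
inv-unique x y xy≡1 with x ≟ 0ℚ
... | yes refl = ⊥-elim (1≢0 (trans (sym xy≡1) (*-zeroˡ y)))
... | no x≢0 = let instance _ = ≢-nonZero x≢0 in begin
  1/ x            ≡⟨ sym (*-identityʳ (1/ x)) ⟩
  1/ x * 1ℚ       ≡⟨ cong (1/ x *_) (sym xy≡1) ⟩
  1/ x * (x * y)  ≡⟨ sym (*-assoc (1/ x) x y) ⟩
  1/ x * x * y    ≡⟨ cong (_* y) (*-inverseˡ x) ⟩
  1ℚ * y          ≡⟨ *-identityˡ y ⟩
  y               ∎
  where open ≡-Reasoning

inv-distrib-* : ∀ x y → x ≢ 0ℚ → y ≢ 0ℚ → inv (x * y) ≡ inv x * inv y
inv-distrib-* x y x≢0 y≢0 = inv-unique (x * y) (inv x * inv y) (begin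
  x * y * (inv x * inv y)    ≡⟨ *-interchange x y (inv x) (inv y) ⟩
  x * inv x * (y * inv y)    ≡⟨ cong₂ _*_ (inv-inverseʳ x x≢0) (inv-inverseʳ y y≢0) ⟩
  1ℚ                         ∎)
  where open ≡-Reasoning

^ℕ-homo-+ : ∀ x m n → x ^ℕ (m ℕ.+ n) ≡ x ^ℕ m * x ^ℕ n
^ℕ-homo-+ x zero    n = sym (*-identityˡ _)
^ℕ-homo-+ x (suc m) n = trans (cong (x *_) (^ℕ-homo-+ x m n)) (sym (*-assoc x _ _))

^ℕ-distrib-* : ∀ x y n → (x * y) ^ℕ n ≡ x ^ℕ n * y ^ℕ n
^ℕ-distrib-* x y zero    = refl
^ℕ-distrib-* x y (suc n) =
  trans (cong (x * y *_) (^ℕ-distrib-* x y n)) (*-interchange x y (x ^ℕ n) (y ^ℕ n))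

1^ℕ : ∀ n → 1ℚ ^ℕ n ≡ 1ℚ
1^ℕ zero    = refl
1^ℕ (suc n) = trans (*-identityˡ _) (1^ℕ n)

^ℕ-≢0 : ∀ x n → x ≢ 0ℚ → x ^ℕ n ≢ 0ℚ
^ℕ-≢0 x zero    x≢0 ()
^ℕ-≢0 x (suc n) x≢0 = *-≢0 x _ x≢0 (^ℕ-≢0 x n x≢0)

∣^ℕ∣ : ∀ x n → ∣ x ^ℕ n ∣ ≡ ∣ x ∣ ^ℕ n
∣^ℕ∣ x zero    = refl
∣^ℕ∣ x (suc n) = trans (∣p*q∣≡∣p∣*∣q∣ x (x ^ℕ n)) (cong (∣ x ∣ *_) (∣^ℕ∣ x n))

^ℕ-suc-<1 : ∀ p n → 0ℚ ≤ p → p < 1ℚ → p ^ℕ suc n < 1ℚ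
^ℕ-suc-<1 p zero    0≤p p<1 = ≤-<-trans (≤-reflexive (*-identityʳ p)) p<1
^ℕ-suc-<1 p (suc n) 0≤p p<1 = let instance _ = nonNegative 0≤p in
  ≤-<-trans (*-monoˡ-≤-nonNeg p (<⇒≤ (^ℕ-suc-<1 p n 0≤p p<1)))
            (≤-<-trans (≤-reflexive (*-identityʳ p)) p<1)

^ℕ-suc->1 : ∀ p n → 1ℚ < p → 1ℚ < p ^ℕ suc n
^ℕ-suc->1 p zero    1<p = <-≤-trans 1<p (≤-reflexive (sym (*-identityʳ p)))
^ℕ-suc->1 p (suc n) 1<p = let instance _ = nonNegative (≤-trans (*≤* (ℤ.+≤+ ℕ.z≤n)) (<⇒≤ 1<p)) in
  <-≤-trans 1<p (≤-trans (≤-reflexive (sym (*-identityʳ p)))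
                         (*-monoˡ-≤-nonNeg p (<⇒≤ (^ℕ-suc->1 p n 1<p))))

^ℕ-suc≢1 : ∀ q → q ≢ 1ℚ → q ≢ - 1ℚ → ∀ n → q ^ℕ suc n ≢ 1ℚ
^ℕ-suc≢1 q q≢1 q≢-1 n qⁿ⁺¹≡1
  with <-cmp ∣ q ∣ 1ℚ | trans (sym (∣^ℕ∣ q (suc n))) (cong ∣_∣ qⁿ⁺¹≡1)
... | tri< ∣q∣<1 _ _ | ∣qⁿ⁺¹∣≡1 = <-irrefl ∣qⁿ⁺¹∣≡1 (^ℕ-suc-<1 ∣ q ∣ n (0≤∣p∣ q) ∣q∣<1)
... | tri> _ _ ∣q∣>1 | ∣qⁿ⁺¹∣≡1 = <-irrefl (sym ∣qⁿ⁺¹∣≡1) (^ℕ-suc->1 ∣ q ∣ n ∣q∣>1)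
... | tri≈ _ ∣q∣≡1 _ | _ with ∣p∣≡p∨∣p∣≡-p q
...   | inj₁ ∣q∣≡q  = q≢1 (trans (sym ∣q∣≡q) ∣q∣≡1)
...   | inj₂ ∣q∣≡-q = q≢-1 (trans (sym (⁻¹-involutive q)) (cong -_ (trans (sym ∣q∣≡-q) ∣q∣≡1)))

NonRootOfUnity : ℚ → Set
NonRootOfUnity x = ∀ n → 1ℚ - x ^ℕ suc n ≢ 0ℚ

≢±1⇒nonRootOfUnity : ∀ q → q ≢ 1ℚ → q ≢ - 1ℚ → NonRootOfUnity q
≢±1⇒nonRootOfUnity q q≢1 q≢-1 n 1-qⁿ⁺¹≡0 =
  ^ℕ-suc≢1 q q≢1 q≢-1 n (sym (x∙y⁻¹≈ε⇒x≈y 1ℚ (q ^ℕ suc n) 1-qⁿ⁺¹≡0))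

nonRootOfUnity-square : ∀ x → NonRootOfUnity x → NonRootOfUnity (x * x)
nonRootOfUnity-square x x-nru n = subst (λ y → 1ℚ - y ≢ 0ℚ) x²ⁿ⁺²≡[x²]ⁿ⁺¹ (x-nru (n ℕ.+ suc n))
  where
  x²ⁿ⁺²≡[x²]ⁿ⁺¹ : x ^ℕ suc (n ℕ.+ suc n) ≡ (x * x) ^ℕ suc n
  x²ⁿ⁺²≡[x²]ⁿ⁺¹ = trans (^ℕ-homo-+ x (suc n) (suc n)) (sym (^ℕ-distrib-* x x (suc n)))

qpoch-≢0 : ∀ x → NonRootOfUnity x → ∀ n → qpoch x n ≢ 0ℚ
qpoch-≢0 x x-nru zero    ()
qpoch-≢0 x x-nru (suc n) = *-≢0 _ _ (qpoch-≢0 x x-nru n) (x-nru n)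

^ℤ-⊖-* : ∀ x → x ≢ 0ℚ → ∀ m n → x ^ℤ (m ⊖ n) * x ^ℕ n ≡ x ^ℕ m
^ℤ-⊖-* x x≢0 m       zero    = *-identityʳ _
^ℤ-⊖-* x x≢0 zero    (suc n) =
  trans (*-comm (inv (x ^ℕ suc n)) (x ^ℕ suc n)) (inv-inverseʳ _ (^ℕ-≢0 x (suc n) x≢0))
^ℤ-⊖-* x x≢0 (suc m) (suc n) = begin
  x ^ℤ (suc m ⊖ suc n) * (x * x ^ℕ n)  ≡⟨ cong (λ z → x ^ℤ z * (x * x ^ℕ n)) (ℤP.[1+m]⊖[1+n]≡m⊖n m n) ⟩
  x ^ℤ (m ⊖ n) * (x * x ^ℕ n)          ≡⟨ x∙yz≈y∙xz (x ^ℤ (m ⊖ n)) x (x ^ℕ n) ⟩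
  x * (x ^ℤ (m ⊖ n) * x ^ℕ n)          ≡⟨ cong (x *_) (^ℤ-⊖-* x x≢0 m n) ⟩
  x * x ^ℕ m                           ∎
  where open ≡-Reasoning

^ℤ-⊖ : ∀ x → x ≢ 0ℚ → ∀ m n → x ^ℤ (m ⊖ n) ≡ x ^ℕ m * inv (x ^ℕ n)
^ℤ-⊖ x x≢0 m n = begin
  x ^ℤ (m ⊖ n)                            ≡⟨ sym (*-identityʳ _) ⟩
  x ^ℤ (m ⊖ n) * 1ℚ                       ≡⟨ cong (x ^ℤ (m ⊖ n) *_) (sym (inv-inverseʳ _ (^ℕ-≢0 x n x≢0))) ⟩
  x ^ℤ (m ⊖ n) * (x ^ℕ n * inv (x ^ℕ n))  ≡⟨ sym (*-assoc (x ^ℤ (m ⊖ n)) (x ^ℕ n) (inv (x ^ℕ n))) ⟩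
  x ^ℤ (m ⊖ n) * x ^ℕ n * inv (x ^ℕ n)    ≡⟨ cong (_* inv (x ^ℕ n)) (^ℤ-⊖-* x x≢0 m n) ⟩
  x ^ℕ m * inv (x ^ℕ n)                   ∎
  where open ≡-Reasoning

^ℤ-homo-+ : ∀ x → x ≢ 0ℚ → ∀ a b → x ^ℤ (a ℤ.+ b) ≡ x ^ℤ a * x ^ℤ b
^ℤ-homo-+ x x≢0 (+ m)    (+ n)    = ^ℕ-homo-+ x m n
^ℤ-homo-+ x x≢0 (+ m)    -[1+ n ] = ^ℤ-⊖ x x≢0 m (suc n)
^ℤ-homo-+ x x≢0 -[1+ m ] (+ n)    = trans (^ℤ-⊖ x x≢0 n (suc m)) (*-comm (x ^ℕ n) (inv (x ^ℕ suc m)))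
^ℤ-homo-+ x x≢0 -[1+ m ] -[1+ n ] = begin
  inv (x ^ℕ suc (suc (m ℕ.+ n)))       ≡⟨ cong (λ k → inv (x ^ℕ suc k)) (sym (ℕP.+-suc m n)) ⟩
  inv (x ^ℕ (suc m ℕ.+ suc n))         ≡⟨ cong inv (^ℕ-homo-+ x (suc m) (suc n)) ⟩
  inv (x ^ℕ suc m * x ^ℕ suc n)        ≡⟨ inv-distrib-* _ _ (^ℕ-≢0 x (suc m) x≢0) (^ℕ-≢0 x (suc n) x≢0) ⟩
  inv (x ^ℕ suc m) * inv (x ^ℕ suc n)  ∎
  where open ≡-Reasoning

parity : ∀ r → (r % 2 ≡ 0 × (- 1ℚ) ^ℕ r ≡ 1ℚ) ⊎ (r % 2 ≡ 1 × (- 1ℚ) ^ℕ r ≡ - 1ℚ)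
parity zero          = inj₁ (refl , refl)
parity (suc zero)    = inj₂ (refl , refl)
parity (suc (suc r)) with parity r | trans (cong (_% 2) (ℕP.+-comm 2 r)) (ℕD.[m+n]%n≡m%n r 2)
... | inj₁ (r%2≡0 , sign) | [r+2]%2≡r%2 = inj₁ (trans [r+2]%2≡r%2 r%2≡0 , cong (λ u → - 1ℚ * (- 1ℚ * u)) sign)
... | inj₂ (r%2≡1 , sign) | [r+2]%2≡r%2 = inj₂ (trans [r+2]%2≡r%2 r%2≡1 , cong (λ u → - 1ℚ * (- 1ℚ * u)) sign)

-1^ℤ≡±1 : ∀ t → (- 1ℚ) ^ℤ t ≡ 1ℚ ⊎ (- 1ℚ) ^ℤ t ≡ - 1ℚ
-1^ℤ≡±1 (+ n) with parity n
... | inj₁ (_ , sign) = inj₁ sign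
... | inj₂ (_ , sign) = inj₂ sign
-1^ℤ≡±1 -[1+ n ] with parity (suc n)
... | inj₁ (_ , sign) = inj₁ (cong inv sign)
... | inj₂ (_ , sign) = inj₂ (cong inv sign)

-1^ℤ-even : ∀ j → (- 1ℚ) ^ℤ (+ 2 ℤ.* j) ≡ 1ℚ
-1^ℤ-even j = trans (cong ((- 1ℚ) ^ℤ_) (2j≡j+j j)) (trans (^ℤ-homo-+ (- 1ℚ) (λ ()) j j) (square≡1 (-1^ℤ≡±1 j)))
  where
  2j≡j+j : ∀ j → + 2 ℤ.* j ≡ j ℤ.+ j
  2j≡j+j = ZS.solve-∀
  square≡1 : ∀ {x} → x ≡ 1ℚ ⊎ x ≡ - 1ℚ → x * x ≡ 1ℚ
  square≡1 (inj₁ refl) = refl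
  square≡1 (inj₂ refl) = refl

-1^ℤ-odd : ∀ j → (- 1ℚ) ^ℤ (+ 2 ℤ.* j ℤ.- ℤ.1ℤ) ≡ - 1ℚ
-1^ℤ-odd j = trans (^ℤ-homo-+ (- 1ℚ) (λ ()) (+ 2 ℤ.* j) -[1+ 0 ]) (cong (_* inv (- 1ℚ * 1ℚ)) (-1^ℤ-even j))

1^ℤ : ∀ t → 1ℚ ^ℤ t ≡ 1ℚ
1^ℤ (+ n)    = 1^ℕ n
1^ℤ -[1+ n ] = cong inv (1^ℕ (suc n))

-- Gaussian binomials

qbin : ℚ → ℕ → ℕ → ℚ
qbin x n       zero    = 1ℚ
qbin x zero    (suc k) = 0ℚ
qbin x (suc n) (suc k) = qbin x n k + x ^ℕ suc k * qbin x n (suc k)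

k>n⇒qbin≡0 : ∀ x n k → n ℕ.< k → qbin x n k ≡ 0ℚ
k>n⇒qbin≡0 x zero    (suc k) n<k           = refl
k>n⇒qbin≡0 x (suc n) (suc k) (ℕ.s≤s n<k) = begin
  qbin x n k + x ^ℕ suc k * qbin x n (suc k)
    ≡⟨ cong₂ (λ u v → u + x ^ℕ suc k * v) (k>n⇒qbin≡0 x n k n<k) (k>n⇒qbin≡0 x n (suc k) (ℕP.m<n⇒m<1+n n<k)) ⟩
  0ℚ + x ^ℕ suc k * 0ℚ
    ≡⟨ trans (+-identityˡ (x ^ℕ suc k * 0ℚ)) (*-zeroʳ (x ^ℕ suc k)) ⟩
  0ℚ ∎
  where open ≡-Reasoning

qbin-nn≡1 : ∀ x n → qbin x n n ≡ 1ℚ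
qbin-nn≡1 x zero    = refl
qbin-nn≡1 x (suc n) = begin
  qbin x n n + x ^ℕ suc n * qbin x n (suc n)
    ≡⟨ cong₂ (λ u v → u + x ^ℕ suc n * v) (qbin-nn≡1 x n) (k>n⇒qbin≡0 x n (suc n) (ℕP.n<1+n n)) ⟩
  1ℚ + x ^ℕ suc n * 0ℚ
    ≡⟨ trans (cong (λ u → 1ℚ + u) (*-zeroʳ (x ^ℕ suc n))) (+-identityʳ 1ℚ) ⟩
  1ℚ ∎
  where open ≡-Reasoning

qbin₂ : ℚ → ℕ → ℕ → ℚ
qbin₂ x k m = qbin x (k ℕ.+ m) k

qbin₂-pascal : ∀ x k m → qbin₂ x (suc k) (suc m) ≡ qbin₂ x k (suc m) + x ^ℕ suc k * qbin₂ x (suc k) m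
qbin₂-pascal x k m = cong (λ n → qbin x (k ℕ.+ suc m) k + x ^ℕ suc k * qbin x n (suc k)) (ℕP.+-suc k m)

qbin₂-k0≡1 : ∀ x k → qbin₂ x k 0 ≡ 1ℚ
qbin₂-k0≡1 x k = trans (cong (λ n → qbin x n k) (ℕP.+-identityʳ k)) (qbin-nn≡1 x k)

qbin₂-*-qpoch : ∀ x k m → qbin₂ x k m * (qpoch x k * qpoch x m) ≡ qpoch x (k ℕ.+ m)
qbin₂-*-qpoch x zero    m    = trans (*-identityˡ _) (*-identityˡ _)
qbin₂-*-qpoch x (suc k) zero = begin
  qbin₂ x (suc k) 0 * (qpoch x (suc k) * 1ℚ) ≡⟨ cong₂ _*_ (qbin₂-k0≡1 x (suc k)) (*-identityʳ (qpoch x (suc k))) ⟩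
  1ℚ * qpoch x (suc k)                       ≡⟨ *-identityˡ (qpoch x (suc k)) ⟩
  qpoch x (suc k)                            ≡⟨ cong (qpoch x) (sym (ℕP.+-identityʳ (suc k))) ⟩
  qpoch x (suc k ℕ.+ 0)                      ∎
  where open ≡-Reasoning
qbin₂-*-qpoch x (suc k) (suc m) = begin
  qbin₂ x (suc k) (suc m) * (qpoch x (suc k) * qpoch x (suc m))
    ≡⟨ cong (_* (qpoch x (suc k) * qpoch x (suc m))) (qbin₂-pascal x k m) ⟩
  (B₁ + xᵏ⁺¹ * B₂) * ((Pₖ * a) * (Pₘ * b))
    ≡⟨ regroup B₁ B₂ xᵏ⁺¹ Pₖ Pₘ a b ⟩
  B₁ * (Pₖ * (Pₘ * b)) * a + xᵏ⁺¹ * b * (B₂ * ((Pₖ * a) * Pₘ))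
    ≡⟨ cong₂ (λ u v → u * a + xᵏ⁺¹ * b * v) (qbin₂-*-qpoch x k (suc m))
             (trans (qbin₂-*-qpoch x (suc k) m) (cong (qpoch x) (sym (ℕP.+-suc k m)))) ⟩
  T * a + x * x ^ℕ k * b * T
    ≡⟨ collect T x (x ^ℕ k) (x ^ℕ m) ⟩
  T * (1ℚ - x * (x ^ℕ k * (x * x ^ℕ m)))
    ≡⟨ cong (λ u → T * (1ℚ - x * u)) (sym (^ℕ-homo-+ x k (suc m))) ⟩
  qpoch x (suc k ℕ.+ suc m) ∎
  where
  open ≡-Reasoning
  B₁ = qbin₂ x k (suc m)
  B₂ = qbin₂ x (suc k) m
  Pₖ = qpoch x k
  Pₘ = qpoch x m
  xᵏ⁺¹ = x ^ℕ suc k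
  a = 1ℚ - x * x ^ℕ k
  b = 1ℚ - x * x ^ℕ m
  T = qpoch x (k ℕ.+ suc m)
  regroup : ∀ B₁ B₂ y Pₖ Pₘ a b →
    (B₁ + y * B₂) * ((Pₖ * a) * (Pₘ * b)) ≡ B₁ * (Pₖ * (Pₘ * b)) * a + y * b * (B₂ * ((Pₖ * a) * Pₘ))
  regroup = Solver.solve-∀ ℚ-ring
  collect : ∀ T x xᵏ xᵐ → T * (1ℚ - x * xᵏ) + x * xᵏ * (1ℚ - x * xᵐ) * T ≡ T * (1ℚ - x * (xᵏ * (x * xᵐ)))
  collect = Solver.solve-∀ ℚ-ring

qbin₂≡qpoch-quotient : ∀ x → NonRootOfUnity x → ∀ k m →
  qbin₂ x k m ≡ qpoch x (k ℕ.+ m) * inv (qpoch x k * qpoch x m)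
qbin₂≡qpoch-quotient x x-nru k m = *-cancelʳ-≢0 _ _ Pₖ*Pₘ Pₖ*Pₘ≢0 (begin
  qbin₂ x k m * Pₖ*Pₘ                            ≡⟨ qbin₂-*-qpoch x k m ⟩
  qpoch x (k ℕ.+ m)                              ≡⟨ sym (*-identityʳ (qpoch x (k ℕ.+ m))) ⟩
  qpoch x (k ℕ.+ m) * 1ℚ                         ≡⟨ cong (qpoch x (k ℕ.+ m) *_) inv-P*P≡1 ⟩
  qpoch x (k ℕ.+ m) * (inv Pₖ*Pₘ * Pₖ*Pₘ)        ≡⟨ sym (*-assoc (qpoch x (k ℕ.+ m)) (inv Pₖ*Pₘ) Pₖ*Pₘ) ⟩
  qpoch x (k ℕ.+ m) * inv Pₖ*Pₘ * Pₖ*Pₘ          ∎)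
  where
  open ≡-Reasoning
  Pₖ*Pₘ = qpoch x k * qpoch x m
  Pₖ*Pₘ≢0 = *-≢0 (qpoch x k) (qpoch x m) (qpoch-≢0 x x-nru k) (qpoch-≢0 x x-nru m)
  inv-P*P≡1 : 1ℚ ≡ inv Pₖ*Pₘ * Pₖ*Pₘ
  inv-P*P≡1 = sym (trans (*-comm (inv Pₖ*Pₘ) Pₖ*Pₘ) (inv-inverseʳ Pₖ*Pₘ Pₖ*Pₘ≢0))

qbin₂-comm : ∀ x → NonRootOfUnity x → ∀ k m → qbin₂ x k m ≡ qbin₂ x m k
qbin₂-comm x x-nru k m = begin
  qbin₂ x k m                                         ≡⟨ qbin₂≡qpoch-quotient x x-nru k m ⟩
  qpoch x (k ℕ.+ m) * inv (qpoch x k * qpoch x m)     ≡⟨ cong₂ (λ n y → qpoch x n * inv y) (ℕP.+-comm k m) (*-comm (qpoch x k) (qpoch x m)) ⟩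
  qpoch x (m ℕ.+ k) * inv (qpoch x m * qpoch x k)     ≡⟨ sym (qbin₂≡qpoch-quotient x x-nru m k) ⟩
  qbin₂ x m k                                         ∎
  where open ≡-Reasoning

qbin₂-pascal′ : ∀ x → NonRootOfUnity x → ∀ k m →
  qbin₂ x (suc k) (suc m) ≡ qbin₂ x (suc k) m + x ^ℕ suc m * qbin₂ x k (suc m)
qbin₂-pascal′ x x-nru k m = begin
  qbin₂ x (suc k) (suc m)                            ≡⟨ qbin₂-comm x x-nru (suc k) (suc m) ⟩
  qbin₂ x (suc m) (suc k)                            ≡⟨ qbin₂-pascal x m k ⟩
  qbin₂ x m (suc k) + x ^ℕ suc m * qbin₂ x (suc m) k
    ≡⟨ cong₂ (λ u v → u + x ^ℕ suc m * v) (qbin₂-comm x x-nru m (suc k)) (qbin₂-comm x x-nru (suc m) k) ⟩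
  qbin₂ x (suc k) m + x ^ℕ suc m * qbin₂ x k (suc m) ∎
  where open ≡-Reasoning

qbinℤ : ℚ → ℕ → ℤ → ℚ
qbinℤ x N (+ k)    = qbin x N k
qbinℤ x N -[1+ k ] = 0ℚ

qbinℤ-⊖≡0 : ∀ x N a n → a ℕ.< n → qbinℤ x N (a ⊖ n) ≡ 0ℚ
qbinℤ-⊖≡0 x N a n a<n rewrite ℤP.⊖-< a<n with n ℕ.∸ a | ℕP.m>n⇒m∸n≢0 a<n
... | zero  | n∸a≢0 = ⊥-elim (n∸a≢0 refl)
... | suc _ | _     = refl

qbinℤ-pascal : ∀ x N m → qbinℤ x (suc N) m ≡ qbinℤ x N (m ℤ.- ℤ.1ℤ) + x ^ℤ m * qbinℤ x N m
qbinℤ-pascal x N (+ zero)   = refl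
qbinℤ-pascal x N (+ suc k)  = refl
qbinℤ-pascal x N -[1+ k ]   = sym (trans (+-identityˡ _) (*-zeroʳ (inv (x ^ℕ suc k))))

qbinℤ-reflect : ∀ x → NonRootOfUnity x → ∀ N m → qbinℤ x N m ≡ qbinℤ x N (+ N ℤ.- m)
qbinℤ-reflect x x-nru N -[1+ k ] = sym (k>n⇒qbin≡0 x N (N ℕ.+ suc k) (ℕP.m<m+n N ℕ.z<s))
qbinℤ-reflect x x-nru N (+ k) with ℕP.≤-<-connex k N
... | inj₂ N<k = trans (k>n⇒qbin≡0 x N k N<k)
                       (sym (trans (cong (qbinℤ x N) (ℤP.m-n≡m⊖n N k)) (qbinℤ-⊖≡0 x N N k N<k)))
... | inj₁ k≤N with ℕP.m≤n⇒∃[o]m+o≡n k≤N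
...   | d , refl = begin
  qbin₂ x k d                                ≡⟨ qbin₂-comm x x-nru k d ⟩
  qbin x (d ℕ.+ k) d                         ≡⟨ cong (λ n → qbin x n d) (ℕP.+-comm d k) ⟩
  qbin x (k ℕ.+ d) d                         ≡⟨ cong (qbinℤ x (k ℕ.+ d)) (sym k+d-k≡d) ⟩
  qbinℤ x (k ℕ.+ d) (+ (k ℕ.+ d) ℤ.- + k)    ∎
  where
  open ≡-Reasoning
  k+d-k≡d : + (k ℕ.+ d) ℤ.- + k ≡ + d
  k+d-k≡d = trans (ℤP.m-n≡m⊖n (k ℕ.+ d) k) (trans (ℤP.⊖-≥ k≤N) (cong +_ (ℕP.m+n∸m≡n k d)))

-- The second Pascal rule is the first one read through the reflection m ↦ N - m.
qbinℤ-pascal′ : ∀ x → NonRootOfUnity x → ∀ N m →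
  qbinℤ x (suc N) m ≡ qbinℤ x N m + x ^ℤ (+ suc N ℤ.- m) * qbinℤ x N (m ℤ.- ℤ.1ℤ)
qbinℤ-pascal′ x x-nru N m = begin
  qbinℤ x (suc N) m
    ≡⟨ qbinℤ-reflect x x-nru (suc N) m ⟩
  qbinℤ x (suc N) m′
    ≡⟨ qbinℤ-pascal x N m′ ⟩
  qbinℤ x N (m′ ℤ.- ℤ.1ℤ) + x ^ℤ m′ * qbinℤ x N m′
    ≡⟨ cong₂ (λ u v → u + x ^ℤ m′ * v) (qbinℤ-reflect x x-nru N (m′ ℤ.- ℤ.1ℤ)) (qbinℤ-reflect x x-nru N m′) ⟩
  qbinℤ x N (+ N ℤ.- (m′ ℤ.- ℤ.1ℤ)) + x ^ℤ m′ * qbinℤ x N (+ N ℤ.- m′)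
    ≡⟨ cong₂ (λ u v → qbinℤ x N u + x ^ℤ m′ * qbinℤ x N v) (reflect-twice (+ N) m) (reflect-twice-1 (+ N) m) ⟩
  qbinℤ x N m + x ^ℤ m′ * qbinℤ x N (m ℤ.- ℤ.1ℤ) ∎
  where
  open ≡-Reasoning
  m′ = + suc N ℤ.- m
  reflect-twice : ∀ n m → n ℤ.- ((ℤ.1ℤ ℤ.+ n ℤ.- m) ℤ.- ℤ.1ℤ) ≡ m
  reflect-twice = ZS.solve-∀
  reflect-twice-1 : ∀ n m → n ℤ.- (ℤ.1ℤ ℤ.+ n ℤ.- m) ≡ m ℤ.- ℤ.1ℤ
  reflect-twice-1 = ZS.solve-∀

gauss≡qbinℤ : ∀ x → NonRootOfUnity x → ∀ N m → gauss x (+ N) m ≡ qbinℤ x N m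
gauss≡qbinℤ x x-nru N -[1+ k ] = refl
gauss≡qbinℤ x x-nru N (+ k) with ℕP.≤-<-connex k N
... | inj₁ k≤N with ℕP.m≤n⇒∃[o]m+o≡n k≤N
...   | d , refl rewrite trans (ℤP.m-n≡m⊖n (k ℕ.+ d) k) (trans (ℤP.⊖-≥ k≤N) (cong +_ (ℕP.m+n∸m≡n k d))) =
  sym (qbin₂≡qpoch-quotient x x-nru k d)
gauss≡qbinℤ x x-nru N (+ k) | inj₂ N<k = trans (gauss-neg N-k≡-[1+k∸N∸1]) (sym (k>n⇒qbin≡0 x N k N<k))
  where
  gauss-neg : ∀ {j} → + N ℤ.- + k ≡ -[1+ j ] → gauss x (+ N) (+ k) ≡ 0ℚ
  gauss-neg eq rewrite eq = refl
  N-k≡-[1+k∸N∸1] : + N ℤ.- + k ≡ -[1+ (k ℕ.∸ suc N) ]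
  N-k≡-[1+k∸N∸1] = trans (ℤP.m-n≡m⊖n N k) (trans (ℤP.⊖-< N<k) (cong (λ u → ℤ.- (+ u)) (ℕP.+-∸-assoc 1 N<k)))

-- Finite sums

sumBelow-suc : ∀ n g → sumBelow (suc n) g ≡ g 0 + sumBelow n (g ∘ suc)
sumBelow-suc zero    g = trans (+-identityˡ (g 0)) (sym (+-identityʳ (g 0)))
sumBelow-suc (suc n) g = trans (cong (_+ g (suc n)) (sumBelow-suc n g)) (+-assoc (g 0) _ _)

sumBelow-cong : ∀ n {g h : ℕ → ℚ} → (∀ r → g r ≡ h r) → sumBelow n g ≡ sumBelow n h
sumBelow-cong zero    g≗h = refl
sumBelow-cong (suc n) g≗h = cong₂ _+_ (sumBelow-cong n g≗h) (g≗h n)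

sumBelow-plus : ∀ n g h → sumBelow n (λ r → g r + h r) ≡ sumBelow n g + sumBelow n h
sumBelow-plus zero    g h = refl
sumBelow-plus (suc n) g h =
  trans (cong (_+ (g n + h n)) (sumBelow-plus n g h)) (interchange (sumBelow n g) (sumBelow n h) (g n) (h n))
  where
  interchange : ∀ a b c d → a + b + (c + d) ≡ a + c + (b + d)
  interchange = Solver.solve-∀ ℚ-ring

sumBelow-minus : ∀ n g h → sumBelow n (λ r → g r - h r) ≡ sumBelow n g - sumBelow n h
sumBelow-minus zero    g h = refl
sumBelow-minus (suc n) g h = trans (cong (_+ (g n - h n)) (sumBelow-minus n g h)) (regroup (sumBelow n g) (sumBelow n h) (g n) (h n))
  where
  regroup : ∀ a b c d → a - b + (c - d) ≡ a + c - (b + d)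
  regroup = Solver.solve-∀ ℚ-ring

sumBelow-* : ∀ n c g → sumBelow n (λ r → c * g r) ≡ c * sumBelow n g
sumBelow-* zero    c g = sym (*-zeroʳ c)
sumBelow-* (suc n) c g = trans (cong (_+ c * g n) (sumBelow-* n c g)) (sym (*-distribˡ-+ c _ _))

sumBelow-stable : ∀ n g → (∀ r → n ℕ.≤ r → g r ≡ 0ℚ) → ∀ N → n ℕ.≤ N → sumBelow N g ≡ sumBelow n g
sumBelow-stable n g g≡0 N n≤N with ℕP.m≤n⇒m<n∨m≡n n≤N
... | inj₂ refl = refl
... | inj₁ (ℕ.s≤s n≤N′) =
  trans (cong₂ _+_ (sumBelow-stable n g g≡0 _ n≤N′) (g≡0 _ n≤N′)) (+-identityʳ (sumBelow n g))

sumSym-cong : ∀ B {g h : ℤ → ℚ} → (∀ t → g t ≡ h t) → sumSym B g ≡ sumSym B h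
sumSym-cong zero    g≗h = g≗h (+ 0)
sumSym-cong (suc B) g≗h = cong₃ (λ u v w → u + v + w) (sumSym-cong B g≗h) (g≗h (+ suc B)) (g≗h -[1+ B ])

sumSym-plus : ∀ B g h → sumSym B (λ t → g t + h t) ≡ sumSym B g + sumSym B h
sumSym-plus zero    g h = refl
sumSym-plus (suc B) g h =
  trans (cong (λ u → u + (g (+ suc B) + h (+ suc B)) + (g -[1+ B ] + h -[1+ B ])) (sumSym-plus B g h))
        (regroup (sumSym B g) (sumSym B h) (g (+ suc B)) (h (+ suc B)) (g -[1+ B ]) (h -[1+ B ]))
  where
  regroup : ∀ a b c d e f → a + b + (c + d) + (e + f) ≡ a + c + e + (b + d + f)
  regroup = Solver.solve-∀ ℚ-ring

sumSym-* : ∀ B c g → sumSym B (λ t → c * g t) ≡ c * sumSym B g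
sumSym-* zero    c g = refl
sumSym-* (suc B) c g =
  trans (cong (λ u → u + c * g (+ suc B) + c * g -[1+ B ]) (sumSym-* B c g))
        (factor c (sumSym B g) (g (+ suc B)) (g -[1+ B ]))
  where
  factor : ∀ c a b d → c * a + c * b + c * d ≡ c * (a + b + d)
  factor = Solver.solve-∀ ℚ-ring

sumSym-minus : ∀ B g h → sumSym B (λ t → g t - h t) ≡ sumSym B g - sumSym B h
sumSym-minus B g h = begin
  sumSym B (λ t → g t - h t)                ≡⟨ sumSym-plus B g (λ t → - h t) ⟩
  sumSym B g + sumSym B (λ t → - h t)       ≡⟨ cong (λ u → sumSym B g + u) (sumSym-cong B (λ t → neg-as-* (h t))) ⟩
  sumSym B g + sumSym B (λ t → - 1ℚ * h t)  ≡⟨ cong (λ u → sumSym B g + u) (sumSym-* B (- 1ℚ) h) ⟩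
  sumSym B g + - 1ℚ * sumSym B h            ≡⟨ cong (λ u → sumSym B g + u) (sym (neg-as-* (sumSym B h))) ⟩
  sumSym B g - sumSym B h                   ∎
  where
  open ≡-Reasoning
  neg-as-* : ∀ a → - a ≡ - 1ℚ * a
  neg-as-* = Solver.solve-∀ ℚ-ring

sumSym-neg : ∀ B φ → sumSym B (λ t → φ (ℤ.- t)) ≡ sumSym B φ
sumSym-neg zero    φ = refl
sumSym-neg (suc B) φ =
  trans (cong (λ u → u + φ -[1+ B ] + φ (+ suc B)) (sumSym-neg B φ)) (swap (sumSym B φ) (φ -[1+ B ]) (φ (+ suc B)))
  where
  swap : ∀ a b c → a + b + c ≡ a + c + b
  swap = Solver.solve-∀ ℚ-ring

sumSym-shift : ∀ B φ → sumSym B (λ t → φ (t ℤ.+ ℤ.1ℤ)) ≡ sumSym B φ - φ (ℤ.- (+ B)) + φ (+ suc B)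
sumSym-shift zero    φ = cancel (φ (+ 0)) (φ (+ 1))
  where
  cancel : ∀ a b → b ≡ a - a + b
  cancel = Solver.solve-∀ ℚ-ring
sumSym-shift (suc B) φ = begin
  sumSym B ψ + ψ (+ suc B) + ψ -[1+ B ]
    ≡⟨ cong₃ (λ u v w → u + v + w) (sumSym-shift B φ) (cong (λ n → φ (+ n)) (ℕP.+-comm (suc B) 1)) (cong φ (-[1+B]+1≡-B B)) ⟩
  sumSym B φ - φ (ℤ.- (+ B)) + φ (+ suc B) + φ (+ suc (suc B)) + φ (ℤ.- (+ B))
    ≡⟨ regroup (sumSym B φ) (φ (ℤ.- (+ B))) (φ (+ suc B)) (φ (+ suc (suc B))) (φ -[1+ B ]) ⟩
  sumSym B φ + φ (+ suc B) + φ -[1+ B ] - φ -[1+ B ] + φ (+ suc (suc B)) ∎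
  where
  open ≡-Reasoning
  ψ = λ t → φ (t ℤ.+ ℤ.1ℤ)
  -[1+B]+1≡-B : ∀ b → -[1+ b ] ℤ.+ ℤ.1ℤ ≡ ℤ.- (+ b)
  -[1+B]+1≡-B zero    = refl
  -[1+B]+1≡-B (suc b) = refl
  regroup : ∀ S a b c d → S - a + b + c + a ≡ S + b + d - d + c
  regroup = Solver.solve-∀ ℚ-ring

record Supported (B : ℕ) (φ : ℤ → ℚ) : Set where
  constructor supported
  field
    vanishes⁺ : ∀ K → φ (+ suc (B ℕ.+ K)) ≡ 0ℚ
    vanishes⁻ : ∀ K → φ -[1+ (B ℕ.+ K) ] ≡ 0ℚ
open Supported

supported-+ : ∀ {B} {φ ψ : ℤ → ℚ} → Supported B φ → Supported B ψ → Supported B (λ t → φ t + ψ t)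
supported-+ (supported φ⁺ φ⁻) (supported ψ⁺ ψ⁻) = supported
  (λ K → trans (cong₂ _+_ (φ⁺ K) (ψ⁺ K)) (+-identityˡ 0ℚ))
  (λ K → trans (cong₂ _+_ (φ⁻ K) (ψ⁻ K)) (+-identityˡ 0ℚ))

supported-* : ∀ {B} (g : ℤ → ℚ) {φ : ℤ → ℚ} → Supported B φ → Supported B (λ t → g t * φ t)
supported-* {B} g (supported φ⁺ φ⁻) =
  supported (λ K → scaled (+ suc (B ℕ.+ K)) (φ⁺ K)) (λ K → scaled -[1+ (B ℕ.+ K) ] (φ⁻ K))
  where
  scaled : ∀ t {x} → x ≡ 0ℚ → g t * x ≡ 0ℚ
  scaled t refl = *-zeroʳ (g t)

sumSym-stable : ∀ {B φ} → Supported B φ → ∀ {N N′} → B ℕ.≤ N → B ℕ.≤ N′ → sumSym N φ ≡ sumSym N′ φ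
sumSym-stable {B} {φ} (supported φ⁺ φ⁻) B≤N B≤N′ = trans (to-B B≤N) (sym (to-B B≤N′))
  where
  extend : ∀ K → sumSym (B ℕ.+ K) φ ≡ sumSym B φ
  extend zero    = cong (λ n → sumSym n φ) (ℕP.+-identityʳ B)
  extend (suc K) = begin
    sumSym (B ℕ.+ suc K) φ                                        ≡⟨ cong (λ n → sumSym n φ) (ℕP.+-suc B K) ⟩
    sumSym (B ℕ.+ K) φ + φ (+ suc (B ℕ.+ K)) + φ -[1+ (B ℕ.+ K) ]  ≡⟨ cong₃ (λ u v w → u + v + w) (extend K) (φ⁺ K) (φ⁻ K) ⟩
    sumSym B φ + 0ℚ + 0ℚ                                          ≡⟨ trans (+-identityʳ _) (+-identityʳ (sumSym B φ)) ⟩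
    sumSym B φ                                                    ∎
    where open ≡-Reasoning
  to-B : ∀ {N} → B ℕ.≤ N → sumSym N φ ≡ sumSym B φ
  to-B B≤N with ℕP.m≤n⇒∃[o]m+o≡n B≤N
  ... | K , refl = extend K

sumSym-split-parity : ∀ B φ →
  sumSym B (λ j → φ (+ 2 ℤ.* j) + φ (+ 2 ℤ.* j ℤ.- ℤ.1ℤ)) + φ (+ suc (2 ℕ.* B)) ≡ sumSym (suc (2 ℕ.* B)) φ
sumSym-split-parity zero φ = swap (φ (+ 0)) (φ -[1+ 0 ]) (φ (+ 1))
  where
  swap : ∀ a b c → a + b + c ≡ a + c + b
  swap = Solver.solve-∀ ℚ-ring
sumSym-split-parity (suc b) φ = begin
  sumSym b ψ + (φ (+ 2 ℤ.* + suc b) + φ (+ 2 ℤ.* + suc b ℤ.- ℤ.1ℤ)) + (φ (+ 2 ℤ.* -[1+ b ]) + φ (+ 2 ℤ.* -[1+ b ] ℤ.- ℤ.1ℤ)) + φ (+ suc (2 ℕ.* suc b))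
    ≡⟨ cong₂ (λ u v → sumSym b ψ + u + v + φ (+ suc (2 ℕ.* suc b))) (cong₂ _+_ (cong φ 2[1+b]≡) (cong φ 2[1+b]-1≡)) (cong₂ _+_ (cong φ 2-[1+b]≡) (cong φ 2-[1+b]-1≡)) ⟩
  sumSym b ψ + (φ (+ suc (suc k)) + φ (+ suc k)) + (φ -[1+ suc k ] + φ -[1+ suc (suc k) ]) + φ (+ suc (2 ℕ.* suc b))
    ≡⟨ cong (λ u → sumSym b ψ + (φ (+ suc (suc k)) + φ (+ suc k)) + (φ -[1+ suc k ] + φ -[1+ suc (suc k) ]) + φ (+ suc u)) 2*[1+b]≡ ⟩
  sumSym b ψ + (φ (+ suc (suc k)) + φ (+ suc k)) + (φ -[1+ suc k ] + φ -[1+ suc (suc k) ]) + φ (+ suc (suc (suc k)))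
    ≡⟨ regroup (sumSym b ψ) (φ (+ suc (suc k))) (φ (+ suc k)) (φ -[1+ suc k ]) (φ -[1+ suc (suc k) ]) (φ (+ suc (suc (suc k)))) ⟩
  sumSym b ψ + φ (+ suc k) + φ (+ suc (suc k)) + φ -[1+ suc k ] + φ (+ suc (suc (suc k))) + φ -[1+ suc (suc k) ]
    ≡⟨ cong (λ u → u + φ (+ suc (suc k)) + φ -[1+ suc k ] + φ (+ suc (suc (suc k))) + φ -[1+ suc (suc k) ]) (sumSym-split-parity b φ) ⟩
  sumSym (suc (suc (suc k))) φ
    ≡⟨ cong (λ n → sumSym (suc n) φ) (sym 2*[1+b]≡) ⟩
  sumSym (suc (2 ℕ.* suc b)) φ ∎
  where
  open ≡-Reasoning
  k = 2 ℕ.* b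
  ψ = λ j → φ (+ 2 ℤ.* j) + φ (+ 2 ℤ.* j ℤ.- ℤ.1ℤ)
  2*[1+b]≡ : 2 ℕ.* suc b ≡ suc (suc k)
  2*[1+b]≡ = ℕP.*-suc 2 b
  2[1+b]≡ : + 2 ℤ.* + suc b ≡ + suc (suc k)
  2[1+b]≡ = trans (sym (ℤP.pos-* 2 (suc b))) (cong +_ 2*[1+b]≡)
  2[1+b]-1≡ : + 2 ℤ.* + suc b ℤ.- ℤ.1ℤ ≡ + suc k
  2[1+b]-1≡ = cong (ℤ._- ℤ.1ℤ) 2[1+b]≡
  2-[1+b]≡ : + 2 ℤ.* -[1+ b ] ≡ -[1+ suc k ]
  2-[1+b]≡ = trans (sym (ℤP.neg-distribʳ-* (+ 2) (+ suc b))) (cong ℤ.-_ 2[1+b]≡)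
  2-[1+b]-1≡ : + 2 ℤ.* -[1+ b ] ℤ.- ℤ.1ℤ ≡ -[1+ suc (suc k) ]
  2-[1+b]-1≡ = trans (cong (ℤ._- ℤ.1ℤ) 2-[1+b]≡) (cong (λ x → -[1+ suc x ]) (ℕP.+-identityʳ (suc k)))
  regroup : ∀ S a b c d e → S + (a + b) + (c + d) + e ≡ S + b + a + c + e + d
  regroup = Solver.solve-∀ ℚ-ring

sumSym-interleave : ∀ {B φ} → Supported B φ → ∀ {N N′} → B ℕ.≤ N → B ℕ.≤ N′ →
  sumSym N (λ j → φ (+ 2 ℤ.* j) + φ (+ 2 ℤ.* j ℤ.- ℤ.1ℤ)) ≡ sumSym N′ φ
sumSym-interleave {B} {φ} φ-supp {N} {N′} B≤N B≤N′ = begin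
  sumSym N ψ                              ≡⟨ sym (+-identityʳ (sumSym N ψ)) ⟩
  sumSym N ψ + 0ℚ                         ≡⟨ cong (λ u → sumSym N ψ + u) (sym edge≡0) ⟩
  sumSym N ψ + φ (+ suc (2 ℕ.* N))        ≡⟨ sumSym-split-parity N φ ⟩
  sumSym (suc (2 ℕ.* N)) φ                ≡⟨ sumSym-stable φ-supp (ℕP.m≤n⇒m≤1+n B≤2N) B≤N′ ⟩
  sumSym N′ φ                             ∎
  where
  open ≡-Reasoning
  ψ = λ j → φ (+ 2 ℤ.* j) + φ (+ 2 ℤ.* j ℤ.- ℤ.1ℤ)
  B≤2N : B ℕ.≤ 2 ℕ.* N
  B≤2N = ℕP.≤-trans B≤N (ℕP.m≤n*m N 2)
  edge≡0 : φ (+ suc (2 ℕ.* N)) ≡ 0ℚ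
  edge≡0 with ℕP.m≤n⇒∃[o]m+o≡n B≤2N
  ... | K , B+K≡2N = subst (λ n → φ (+ suc n) ≡ 0ℚ) B+K≡2N (vanishes⁺ φ-supp K)

sumSym-neg-even : ∀ N (φ : ℤ → ℚ) → sumSym N (λ j → φ (ℤ.- (+ 2 ℤ.* j))) ≡ sumSym N (λ j → φ (+ 2 ℤ.* j))
sumSym-neg-even N φ = trans (sumSym-cong N (λ j → cong φ (-[2j]≡2[-j] j))) (sumSym-neg N (λ j → φ (+ 2 ℤ.* j)))
  where
  -[2j]≡2[-j] : ∀ j → ℤ.- (+ 2 ℤ.* j) ≡ + 2 ℤ.* (ℤ.- j)
  -[2j]≡2[-j] = ZS.solve-∀

-- The left-hand side as a polynomial in w

sumBelow-recombine : ∀ n (u g h k : ℕ → ℚ) a b →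
  u 0 ≡ g 0 + a * h 0 → (∀ s → u (suc s) ≡ g (suc s) + (a * h (suc s) + b * k s)) →
  sumBelow (suc n) u ≡ sumBelow (suc n) g + a * sumBelow (suc n) h + b * sumBelow n k
sumBelow-recombine n u g h k a b u₀ uₛ = begin
  sumBelow (suc n) u
    ≡⟨ sumBelow-suc n u ⟩
  u 0 + sumBelow n (u ∘ suc)
    ≡⟨ cong₂ _+_ u₀ (sumBelow-cong n uₛ) ⟩
  g 0 + a * h 0 + sumBelow n (λ s → g (suc s) + (a * h (suc s) + b * k s))
    ≡⟨ cong (λ x → g 0 + a * h 0 + x) (trans (sumBelow-plus n (g ∘ suc) _) (cong (λ x → Σg + x)
         (trans (sumBelow-plus n _ _) (cong₂ _+_ (sumBelow-* n a (h ∘ suc)) (sumBelow-* n b k))))) ⟩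
  g 0 + a * h 0 + (Σg + (a * Σh + b * sumBelow n k))
    ≡⟨ regroup (g 0) (h 0) a b Σg Σh (sumBelow n k) ⟩
  (g 0 + Σg) + a * (h 0 + Σh) + b * sumBelow n k
    ≡⟨ sym (cong₂ (λ x y → x + a * y + b * sumBelow n k) (sumBelow-suc n g) (sumBelow-suc n h)) ⟩
  sumBelow (suc n) g + a * sumBelow (suc n) h + b * sumBelow n k ∎
  where
  open ≡-Reasoning
  Σg = sumBelow n (g ∘ suc)
  Σh = sumBelow n (h ∘ suc)
  regroup : ∀ g₀ h₀ a b x y z → g₀ + a * h₀ + (x + (a * y + b * z)) ≡ (g₀ + x) + a * (h₀ + y) + b * z
  regroup = Solver.solve-∀ ℚ-ring

module LeftSide (q : ℚ) (q²-nru : NonRootOfUnity (q * q)) where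

  Q : ℚ
  Q = q * q

  negQPoch : ℕ → ℚ
  negQPoch zero    = 1ℚ
  negQPoch (suc n) = negQPoch n * (1ℚ + q ^ℕ suc n)

  coeff : ℕ → ℕ → ℚ
  coeff M r = q ^ℕ (r ℕ.* r) * qbin Q M r * negQPoch (M ℕ.∸ r)

  F : ℕ → ℚ → ℚ
  F M w = sumBelow (suc M) (λ r → w ^ℕ r * coeff M r)

  coeff-≡0 : ∀ M r → M ℕ.< r → coeff M r ≡ 0ℚ
  coeff-≡0 M r M<r rewrite k>n⇒qbin≡0 Q M r M<r =
    trans (cong (_* negQPoch (M ℕ.∸ r)) (*-zeroʳ (q ^ℕ (r ℕ.* r)))) (*-zeroˡ (negQPoch (M ℕ.∸ r)))

  coeff-diag : ∀ s → coeff s s ≡ q ^ℕ (s ℕ.* s)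
  coeff-diag s = begin
    q ^ℕ (s ℕ.* s) * qbin Q s s * negQPoch (s ℕ.∸ s)
      ≡⟨ cong₂ (λ u n → q ^ℕ (s ℕ.* s) * u * negQPoch n) (qbin-nn≡1 Q s) (ℕP.n∸n≡0 s) ⟩
    q ^ℕ (s ℕ.* s) * 1ℚ * 1ℚ
      ≡⟨ trans (*-identityʳ _) (*-identityʳ (q ^ℕ (s ℕ.* s))) ⟩
    q ^ℕ (s ℕ.* s) ∎
    where open ≡-Reasoning

  q^[1+s]² : ∀ s → q ^ℕ (suc s ℕ.* suc s) ≡ q ^ℕ (s ℕ.* s) * (q ^ℕ s * q ^ℕ s * q)
  q^[1+s]² s = begin
    q ^ℕ (suc s ℕ.* suc s)                ≡⟨ cong (q ^ℕ_) (square-suc s) ⟩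
    q ^ℕ (s ℕ.* s ℕ.+ (s ℕ.+ s ℕ.+ 1))    ≡⟨ ^ℕ-homo-+ q (s ℕ.* s) _ ⟩
    q ^ℕ (s ℕ.* s) * q ^ℕ (s ℕ.+ s ℕ.+ 1)
      ≡⟨ cong (q ^ℕ (s ℕ.* s) *_) (trans (^ℕ-homo-+ q (s ℕ.+ s) 1) (cong₂ _*_ (^ℕ-homo-+ q s s) (*-identityʳ q))) ⟩
    q ^ℕ (s ℕ.* s) * (q ^ℕ s * q ^ℕ s * q) ∎
    where
    open ≡-Reasoning
    square-suc : ∀ s → suc s ℕ.* suc s ≡ s ℕ.* s ℕ.+ (s ℕ.+ s ℕ.+ 1)
    square-suc = NS.solve-∀

  coeff-step-0 : ∀ M w w′ → w ^ℕ 0 * coeff (suc M) 0 ≡ w ^ℕ 0 * coeff M 0 + q ^ℕ suc M * (w′ ^ℕ 0 * coeff M 0)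
  coeff-step-0 M w w′ = unfold (negQPoch M) (q ^ℕ suc M)
    where
    unfold : ∀ m a → 1ℚ * (1ℚ * 1ℚ * (m * (1ℚ + a))) ≡ 1ℚ * (1ℚ * 1ℚ * m) + a * (1ℚ * (1ℚ * 1ℚ * m))
    unfold = Solver.solve-∀ ℚ-ring

  module BelowDiagonal (s d : ℕ) where
    M = s ℕ.+ suc d
    A = q ^ℕ (s ℕ.* s)
    v = q ^ℕ s
    e = q ^ℕ d
    b₁ = qbin₂ Q (suc s) d
    b₀ = qbin₂ Q s (suc d)
    m = negQPoch d
    G = qbin Q (suc M) (suc s)

    pascal₀ : G ≡ b₀ + q * v * (q * v) * b₁
    pascal₀ = trans (qbin₂-pascal Q s d) (cong (λ u → b₀ + u * b₁) (^ℕ-distrib-* q q (suc s)))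

    pascal₁ : G ≡ b₁ + q * e * (q * e) * b₀
    pascal₁ = trans (qbin₂-pascal′ Q q²-nru s d) (cong (λ u → b₁ + u * b₀) (^ℕ-distrib-* q q (suc d)))

    qᴹ⁺¹ : q ^ℕ suc M ≡ q * (v * (q * e))
    qᴹ⁺¹ = cong (q *_) (^ℕ-homo-+ q s (suc d))

    coeff[M+1,s+1] : coeff (suc M) (suc s) ≡ A * (v * v * q) * G * (m * (1ℚ + q * e))
    coeff[M+1,s+1] = cong₂ _*_ (cong (_* G) (q^[1+s]² s)) (cong negQPoch (ℕP.m+n∸m≡n s (suc d)))

    coeff[M,s+1] : coeff M (suc s) ≡ A * (v * v * q) * b₁ * m
    coeff[M,s+1] = cong₂ _*_ (cong₂ _*_ (q^[1+s]² s) (cong (λ n → qbin Q n (suc s)) (ℕP.+-suc s d)))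
                             (cong negQPoch (trans (cong (ℕ._∸ suc s) (ℕP.+-suc s d)) (ℕP.m+n∸m≡n s d)))

    coeff[M,s] : coeff M s ≡ A * b₀ * (m * (1ℚ + q * e))
    coeff[M,s] = cong (λ n → A * b₀ * negQPoch n) (ℕP.m+n∸m≡n s (suc d))

    -- Split the factor 1 + q^{d+1} of coeff (M + 1) (s + 1) and expand the two copies of
    -- [M + 1, s + 1] by the two different Pascal rules.
    coeff-step-interior : coeff (suc M) (suc s) ≡
      (1ℚ + q ^ℕ suc M * q ^ℕ suc s) * coeff M (suc s) + q ^ℕ suc M * q ^ℕ s * coeff M s
    coeff-step-interior = begin
      coeff (suc M) (suc s)
        ≡⟨ coeff[M+1,s+1] ⟩
      A * (v * v * q) * G * (m * (1ℚ + q * e))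
        ≡⟨ split-factor A v q e m G ⟩
      A * (v * v * q) * m * (G + q * e * G)
        ≡⟨ cong₂ (λ x y → A * (v * v * q) * m * (x + q * e * y)) pascal₁ pascal₀ ⟩
      A * (v * v * q) * m * ((b₁ + q * e * (q * e) * b₀) + q * e * (b₀ + q * v * (q * v) * b₁))
        ≡⟨ expand A v e b₀ b₁ m q ⟩
      (1ℚ + q * (v * (q * e)) * (q * v)) * (A * (v * v * q) * b₁ * m) + q * (v * (q * e)) * v * (A * b₀ * (m * (1ℚ + q * e)))
        ≡⟨ sym (cong₂ _+_ (cong₂ _*_ (cong (λ u → 1ℚ + u * (q * v)) qᴹ⁺¹) coeff[M,s+1]) (cong₂ _*_ (cong (_* v) qᴹ⁺¹) coeff[M,s])) ⟩
      (1ℚ + q ^ℕ suc M * q ^ℕ suc s) * coeff M (suc s) + q ^ℕ suc M * q ^ℕ s * coeff M s ∎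
      where
      open ≡-Reasoning
      split-factor : ∀ A v q e m G → A * (v * v * q) * G * (m * (1ℚ + q * e)) ≡ A * (v * v * q) * m * (G + q * e * G)
      split-factor = Solver.solve-∀ ℚ-ring
      expand : ∀ A v e b₀ b₁ m q →
        A * (v * v * q) * m * ((b₁ + q * e * (q * e) * b₀) + q * e * (b₀ + q * v * (q * v) * b₁))
          ≡ (1ℚ + q * (v * (q * e)) * (q * v)) * (A * (v * v * q) * b₁ * m) + q * (v * (q * e)) * v * (A * b₀ * (m * (1ℚ + q * e)))
      expand = Solver.solve-∀ ℚ-ring

    coeff-step-q-interior : q ^ℕ suc s * coeff (suc M) (suc s) ≡
      q ^ℕ suc s * coeff M (suc s) + q ^ℕ suc M * coeff M (suc s) + q ^ℕ suc M * q ^ℕ suc M * (q ^ℕ s * coeff M s)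
    coeff-step-q-interior = begin
      q * v * coeff (suc M) (suc s)
        ≡⟨ cong (q * v *_) (trans coeff[M+1,s+1] (cong (λ x → A * (v * v * q) * x * (m * (1ℚ + q * e))) pascal₁)) ⟩
      q * v * (A * (v * v * q) * (b₁ + q * e * (q * e) * b₀) * (m * (1ℚ + q * e)))
        ≡⟨ expand A v e b₀ b₁ m q ⟩
      q * v * (A * (v * v * q) * b₁ * m) + q * (v * (q * e)) * (A * (v * v * q) * b₁ * m)
        + q * (v * (q * e)) * (q * (v * (q * e))) * (v * (A * b₀ * (m * (1ℚ + q * e))))
        ≡⟨ sym (cong₂ _+_ (cong₂ _+_ (cong (q * v *_) coeff[M,s+1]) (cong₂ _*_ qᴹ⁺¹ coeff[M,s+1]))
                          (cong₂ _*_ (cong₂ _*_ qᴹ⁺¹ qᴹ⁺¹) (cong (v *_) coeff[M,s]))) ⟩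
      q * v * coeff M (suc s) + q ^ℕ suc M * coeff M (suc s) + q ^ℕ suc M * q ^ℕ suc M * (q ^ℕ s * coeff M s) ∎
      where
      open ≡-Reasoning
      expand : ∀ A v e b₀ b₁ m q →
        q * v * (A * (v * v * q) * (b₁ + q * e * (q * e) * b₀) * (m * (1ℚ + q * e)))
          ≡ q * v * (A * (v * v * q) * b₁ * m) + q * (v * (q * e)) * (A * (v * v * q) * b₁ * m)
            + q * (v * (q * e)) * (q * (v * (q * e))) * (v * (A * b₀ * (m * (1ℚ + q * e))))
      expand = Solver.solve-∀ ℚ-ring

  data Position (s M : ℕ) : Set where
    interior : ∀ d → M ≡ s ℕ.+ suc d → Position s M
    diagonal : M ≡ s → Position s M
    outside  : M ℕ.< s → Position s M

  position : ∀ s M → Position s M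
  position s M with ℕP.<-cmp s M
  ... | tri< s<M _ _ with ℕP.m≤n⇒∃[o]m+o≡n s<M
  ...   | d , refl = interior d (sym (ℕP.+-suc s d))
  position s M | tri≈ _ s≡M _ = diagonal (sym s≡M)
  position s M | tri> _ _ M<s = outside M<s

  coeff-step : ∀ M s → coeff (suc M) (suc s) ≡
    (1ℚ + q ^ℕ suc M * q ^ℕ suc s) * coeff M (suc s) + q ^ℕ suc M * q ^ℕ s * coeff M s
  coeff-step M s with position s M
  ... | interior d refl = BelowDiagonal.coeff-step-interior s d
  ... | diagonal refl = begin
    coeff (suc s) (suc s)                              ≡⟨ trans (coeff-diag (suc s)) (q^[1+s]² s) ⟩
    q ^ℕ (s ℕ.* s) * (q ^ℕ s * q ^ℕ s * q)             ≡⟨ rearrange (q ^ℕ (s ℕ.* s)) (q ^ℕ s) q c ⟩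
    c * 0ℚ + q * q ^ℕ s * q ^ℕ s * q ^ℕ (s ℕ.* s)
      ≡⟨ sym (cong₂ (λ x y → c * x + q * q ^ℕ s * q ^ℕ s * y) (coeff-≡0 s (suc s) (ℕP.n<1+n s)) (coeff-diag s)) ⟩
    c * coeff s (suc s) + q ^ℕ suc s * q ^ℕ s * coeff s s ∎
    where
    open ≡-Reasoning
    c = 1ℚ + q ^ℕ suc s * q ^ℕ suc s
    rearrange : ∀ A v q c → A * (v * v * q) ≡ c * 0ℚ + q * v * v * A
    rearrange = Solver.solve-∀ ℚ-ring
  ... | outside M<s = begin
    coeff (suc M) (suc s)             ≡⟨ coeff-≡0 (suc M) (suc s) (ℕ.s≤s M<s) ⟩
    0ℚ                                ≡⟨ sym (zeros c (q ^ℕ suc M * q ^ℕ s)) ⟩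
    c * 0ℚ + q ^ℕ suc M * q ^ℕ s * 0ℚ
      ≡⟨ sym (cong₂ (λ x y → c * x + q ^ℕ suc M * q ^ℕ s * y) (coeff-≡0 M (suc s) (ℕP.m<n⇒m<1+n M<s)) (coeff-≡0 M s M<s)) ⟩
    c * coeff M (suc s) + q ^ℕ suc M * q ^ℕ s * coeff M s ∎
    where
    open ≡-Reasoning
    c = 1ℚ + q ^ℕ suc M * q ^ℕ suc s
    zeros : ∀ a b → a * 0ℚ + b * 0ℚ ≡ 0ℚ
    zeros = Solver.solve-∀ ℚ-ring

  coeff-step-q : ∀ M s → q ^ℕ suc s * coeff (suc M) (suc s) ≡
    q ^ℕ suc s * coeff M (suc s) + q ^ℕ suc M * coeff M (suc s) + q ^ℕ suc M * q ^ℕ suc M * (q ^ℕ s * coeff M s)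
  coeff-step-q M s with position s M
  ... | interior d refl = BelowDiagonal.coeff-step-q-interior s d
  ... | diagonal refl = begin
    q ^ℕ suc s * coeff (suc s) (suc s)
      ≡⟨ cong (q ^ℕ suc s *_) (trans (coeff-diag (suc s)) (q^[1+s]² s)) ⟩
    q * q ^ℕ s * (q ^ℕ (s ℕ.* s) * (q ^ℕ s * q ^ℕ s * q))
      ≡⟨ rearrange (q ^ℕ (s ℕ.* s)) (q ^ℕ s) q ⟩
    q * q ^ℕ s * 0ℚ + q * q ^ℕ s * 0ℚ + q * q ^ℕ s * (q * q ^ℕ s) * (q ^ℕ s * q ^ℕ (s ℕ.* s))
      ≡⟨ sym (cong₂ (λ x y → q * q ^ℕ s * x + q * q ^ℕ s * x + q * q ^ℕ s * (q * q ^ℕ s) * (q ^ℕ s * y))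
                    (coeff-≡0 s (suc s) (ℕP.n<1+n s)) (coeff-diag s)) ⟩
    q ^ℕ suc s * coeff s (suc s) + q ^ℕ suc s * coeff s (suc s) + q ^ℕ suc s * q ^ℕ suc s * (q ^ℕ s * coeff s s) ∎
    where
    open ≡-Reasoning
    rearrange : ∀ A v q → q * v * (A * (v * v * q)) ≡ q * v * 0ℚ + q * v * 0ℚ + q * v * (q * v) * (v * A)
    rearrange = Solver.solve-∀ ℚ-ring
  ... | outside M<s = begin
    q ^ℕ suc s * coeff (suc M) (suc s)
      ≡⟨ cong (q ^ℕ suc s *_) (coeff-≡0 (suc M) (suc s) (ℕ.s≤s M<s)) ⟩
    q ^ℕ suc s * 0ℚ
      ≡⟨ zeros (q ^ℕ suc s) (q ^ℕ suc M) (q ^ℕ s) ⟩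
    q ^ℕ suc s * 0ℚ + q ^ℕ suc M * 0ℚ + q ^ℕ suc M * q ^ℕ suc M * (q ^ℕ s * 0ℚ)
      ≡⟨ sym (cong₂ (λ x y → q ^ℕ suc s * x + q ^ℕ suc M * x + q ^ℕ suc M * q ^ℕ suc M * (q ^ℕ s * y))
                    (coeff-≡0 M (suc s) (ℕP.m<n⇒m<1+n M<s)) (coeff-≡0 M s M<s)) ⟩
    q ^ℕ suc s * coeff M (suc s) + q ^ℕ suc M * coeff M (suc s) + q ^ℕ suc M * q ^ℕ suc M * (q ^ℕ s * coeff M s) ∎
    where
    open ≡-Reasoning
    zeros : ∀ a b c → a * 0ℚ ≡ a * 0ℚ + b * 0ℚ + b * b * (c * 0ℚ)
    zeros = Solver.solve-∀ ℚ-ring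

  F-extend : ∀ M w → sumBelow (suc (suc M)) (λ r → w ^ℕ r * coeff M r) ≡ F M w
  F-extend M w = trans (cong (λ u → F M w + w ^ℕ suc M * u) (coeff-≡0 M (suc M) (ℕP.n<1+n M)))
                       (trans (cong (λ u → F M w + u) (*-zeroʳ (w ^ℕ suc M))) (+-identityʳ (F M w)))

  F-step : ∀ M w → F (suc M) w ≡ F M w + (1ℚ + w) * q ^ℕ suc M * F M (w * q)
  F-step M w = begin
    F (suc M) w
      ≡⟨ sumBelow-recombine (suc M) (λ r → w ^ℕ r * coeff (suc M) r) G H H a (w * a) (coeff-step-0 M w (w * q)) weighted-step ⟩
    sumBelow (suc (suc M)) G + a * sumBelow (suc (suc M)) H + w * a * F M (w * q)
      ≡⟨ cong₂ (λ x y → x + a * y + w * a * F M (w * q)) (F-extend M w) (F-extend M (w * q)) ⟩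
    F M w + a * F M (w * q) + w * a * F M (w * q)
      ≡⟨ collect (F M w) a w (F M (w * q)) ⟩
    F M w + (1ℚ + w) * a * F M (w * q) ∎
    where
    open ≡-Reasoning
    a = q ^ℕ suc M
    G H : ℕ → ℚ
    G r = w ^ℕ r * coeff M r
    H r = (w * q) ^ℕ r * coeff M r
    weighted-step : ∀ s → w ^ℕ suc s * coeff (suc M) (suc s) ≡ G (suc s) + (a * H (suc s) + w * a * H s)
    weighted-step s = begin
      w ^ℕ suc s * coeff (suc M) (suc s)
        ≡⟨ cong (w ^ℕ suc s *_) (coeff-step M s) ⟩
      w * w ^ℕ s * ((1ℚ + a * (q * q ^ℕ s)) * coeff M (suc s) + a * q ^ℕ s * coeff M s)
        ≡⟨ expand w (w ^ℕ s) q (q ^ℕ s) a (coeff M (suc s)) (coeff M s) ⟩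
      w * w ^ℕ s * coeff M (suc s) + (a * ((w * q) * (w ^ℕ s * q ^ℕ s) * coeff M (suc s)) + w * a * ((w ^ℕ s * q ^ℕ s) * coeff M s))
        ≡⟨ cong (λ x → w * w ^ℕ s * coeff M (suc s) + (a * ((w * q) * x * coeff M (suc s)) + w * a * (x * coeff M s)))
                (sym (^ℕ-distrib-* w q s)) ⟩
      G (suc s) + (a * H (suc s) + w * a * H s) ∎
      where
      expand : ∀ w wˢ q qˢ a c₁ c₀ →
        w * wˢ * ((1ℚ + a * (q * qˢ)) * c₁ + a * qˢ * c₀) ≡ w * wˢ * c₁ + (a * ((w * q) * (wˢ * qˢ) * c₁) + w * a * ((wˢ * qˢ) * c₀))
      expand = Solver.solve-∀ ℚ-ring
    collect : ∀ F a w F′ → F + a * F′ + w * a * F′ ≡ F + (1ℚ + w) * a * F′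
    collect = Solver.solve-∀ ℚ-ring

  F-step-q : ∀ M → F (suc M) q ≡ (1ℚ + q ^ℕ suc M * q ^ℕ suc M) * F M q + q ^ℕ suc M * F M 1ℚ
  F-step-q M = begin
    F (suc M) q
      ≡⟨ sumBelow-recombine (suc M) (λ r → q ^ℕ r * coeff (suc M) r) G H G a (a * a) (coeff-step-0 M q 1ℚ) weighted-step ⟩
    sumBelow (suc (suc M)) G + a * sumBelow (suc (suc M)) H + a * a * F M q
      ≡⟨ cong₂ (λ x y → x + a * y + a * a * F M q) (F-extend M q) (F-extend M 1ℚ) ⟩
    F M q + a * F M 1ℚ + a * a * F M q
      ≡⟨ collect (F M q) a (F M 1ℚ) ⟩
    (1ℚ + a * a) * F M q + a * F M 1ℚ ∎
    where
    open ≡-Reasoning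
    a = q ^ℕ suc M
    G H : ℕ → ℚ
    G r = q ^ℕ r * coeff M r
    H r = 1ℚ ^ℕ r * coeff M r
    weighted-step : ∀ s → q ^ℕ suc s * coeff (suc M) (suc s) ≡ G (suc s) + (a * H (suc s) + a * a * G s)
    weighted-step s = begin
      q ^ℕ suc s * coeff (suc M) (suc s)
        ≡⟨ coeff-step-q M s ⟩
      G (suc s) + a * coeff M (suc s) + a * a * G s
        ≡⟨ +-assoc (G (suc s)) (a * coeff M (suc s)) (a * a * G s) ⟩
      G (suc s) + (a * coeff M (suc s) + a * a * G s)
        ≡⟨ cong (λ u → G (suc s) + (a * u + a * a * G s)) (sym (trans (cong (_* coeff M (suc s)) (1^ℕ (suc s))) (*-identityˡ _))) ⟩
      G (suc s) + (a * H (suc s) + a * a * G s) ∎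
    collect : ∀ F a F′ → F + a * F′ + a * a * F ≡ (1ℚ + a * a) * F + a * F′
    collect = Solver.solve-∀ ℚ-ring

  F-at-−1 : ∀ M → F M (- 1ℚ) ≡ 1ℚ
  F-at-−1 zero    = refl
  F-at-−1 (suc M) = begin
    F (suc M) (- 1ℚ)                                           ≡⟨ F-step M (- 1ℚ) ⟩
    F M (- 1ℚ) + (1ℚ + - 1ℚ) * q ^ℕ suc M * F M (- 1ℚ * q)     ≡⟨ cong (λ u → u + (1ℚ + - 1ℚ) * q ^ℕ suc M * F M (- 1ℚ * q)) (F-at-−1 M) ⟩
    1ℚ + 0ℚ * q ^ℕ suc M * F M (- 1ℚ * q)                      ≡⟨ vanish (q ^ℕ suc M) (F M (- 1ℚ * q)) ⟩
    1ℚ                                                         ∎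
    where
    open ≡-Reasoning
    vanish : ∀ a b → 1ℚ + 0ℚ * a * b ≡ 1ℚ
    vanish = Solver.solve-∀ ℚ-ring

-- The right-hand side

idx : ℕ → ℤ → ℤ → ℤ
idx M c t = + M ℤ.+ (+ 3 ℤ.* t ℤ.+ c)

qbinℤ-idx-supported : ∀ x M N c → N ℕ.≤ suc (2 ℕ.* M) → c ℕ.≤ 2 → Supported M (λ t → qbinℤ x N (idx M (+ c) t))
qbinℤ-idx-supported x M N c N≤2M+1 c≤2 = supported above below
  where
  above : ∀ K → qbinℤ x N (idx M (+ c) (+ suc (M ℕ.+ K))) ≡ 0ℚ
  above K = k>n⇒qbin≡0 x N _
    (ℕP.≤-<-trans N≤2M+1 (subst (suc (2 ℕ.* M) ℕ.<_) (sym (index≡ M K c)) (ℕP.m<m+n _ ℕ.z<s)))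
    where
    index≡ : ∀ M K c → M ℕ.+ (3 ℕ.* suc (M ℕ.+ K) ℕ.+ c) ≡ suc (2 ℕ.* M) ℕ.+ suc (2 ℕ.* M ℕ.+ 3 ℕ.* K ℕ.+ 1 ℕ.+ c)
    index≡ = NS.solve-∀
  below : ∀ K → qbinℤ x N (idx M (+ c) -[1+ (M ℕ.+ K) ]) ≡ 0ℚ
  below K = trans (cong (qbinℤ x N) (ℤP.distribʳ-⊖-+-pos M c (suc w)))
    (qbinℤ-⊖≡0 x N (M ℕ.+ c) (suc w) (ℕ.s≤s (ℕP.≤-trans (ℕP.+-monoʳ-≤ M c≤2)
      (subst (M ℕ.+ 2 ℕ.≤_) (sym (w≡ M K)) (ℕP.m≤m+n (M ℕ.+ 2) (2 ℕ.* M ℕ.+ 3 ℕ.* K))))))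
    where
    w = M ℕ.+ K ℕ.+ 2 ℕ.* suc (M ℕ.+ K)
    w≡ : ∀ M K → M ℕ.+ K ℕ.+ 2 ℕ.* suc (M ℕ.+ K) ≡ M ℕ.+ 2 ℕ.+ (2 ℕ.* M ℕ.+ 3 ℕ.* K)
    w≡ = NS.solve-∀

qbinℤ-idx-1-supported : ∀ x M N → N ℕ.≤ suc (2 ℕ.* M) → Supported M (λ t → qbinℤ x N (idx M -[1+ 0 ] t))
qbinℤ-idx-1-supported x M N N≤2M+1 = supported above below
  where
  above : ∀ K → qbinℤ x N (idx M -[1+ 0 ] (+ suc (M ℕ.+ K))) ≡ 0ℚ
  above K = k>n⇒qbin≡0 x N _
    (ℕP.≤-<-trans N≤2M+1 (subst (suc (2 ℕ.* M) ℕ.<_) (sym (index≡ M K)) (ℕP.m<m+n _ ℕ.z<s)))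
    where
    -- the left-hand side is the normal form of idx M -[1+ 0 ] (+ suc (M + K))
    index≡ : ∀ M K → M ℕ.+ ((M ℕ.+ K) ℕ.+ (suc (M ℕ.+ K) ℕ.+ (suc (M ℕ.+ K) ℕ.+ 0))) ≡ suc (2 ℕ.* M) ℕ.+ suc (2 ℕ.* M ℕ.+ 3 ℕ.* K)
    index≡ = NS.solve-∀
  below : ∀ K → qbinℤ x N (idx M -[1+ 0 ] -[1+ (M ℕ.+ K) ]) ≡ 0ℚ
  below K = qbinℤ-⊖≡0 x N M _ (ℕ.s≤s (ℕP.≤-trans (ℕP.m≤m+n M K)
    (ℕP.≤-trans (ℕP.m≤m+n (M ℕ.+ K) _) (ℕP.≤-trans (ℕP.m≤m+n _ 0) (ℕP.n≤1+n _)))))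

e₀ e₁ : ℤ → ℤ
e₀ t = + 6 ℤ.* t ℤ.* t ℤ.- t
e₁ t = + 6 ℤ.* t ℤ.* t ℤ.+ + 5 ℤ.* t ℤ.+ + 1

θ₀ θ₁ : ℚ → ℕ → ℤ → ℚ
θ₀ q M t = q ^ℤ e₀ t * qbinℤ q (2 ℕ.* M) (idx M (+ 0) t)
θ₁ q M t = q ^ℤ e₁ t * qbinℤ q (2 ℕ.* M) (idx M (+ 1) t)

signedθ : ℚ → ℚ → ℚ → ℕ → ℤ → ℚ
signedθ q σ ε M t = σ ^ℤ t * (θ₀ q M t + ε * θ₁ q M t)

signedθ-supported : ∀ q σ ε M → Supported M (signedθ q σ ε M)
signedθ-supported q σ ε M = supported-* (σ ^ℤ_) (supported-+
  (supported-* (λ t → q ^ℤ e₀ t) (qbinℤ-idx-supported q M (2 ℕ.* M) 0 (ℕP.n≤1+n _) ℕ.z≤n))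
  (supported-* (λ _ → ε) (supported-* (λ t → q ^ℤ e₁ t) (qbinℤ-idx-supported q M (2 ℕ.* M) 1 (ℕP.n≤1+n _) (ℕ.s≤s ℕ.z≤n)))))

-- termB, …, termW are auxiliary families (binomials of order 2M + 1, or shifted indices) through
-- which the two Pascal rules connect termA M to termA (M + 1).
module RightSide (q : ℚ) (q≢0 : q ≢ 0ℚ) (q-nru : NonRootOfUnity q) (σ ε : ℚ) (σ≢0 : σ ≢ 0ℚ) where

  eZ eU eW : ℤ → ℤ
  eZ t = + 6 ℤ.* t ℤ.* t ℤ.+ + 2 ℤ.* t
  eU t = + 6 ℤ.* t ℤ.* t ℤ.- + 4 ℤ.* t
  eW t = + 6 ℤ.* t ℤ.* t ℤ.+ + 8 ℤ.* t ℤ.+ + 2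

  N₀ N₁ : ℕ → ℕ
  N₀ M = 2 ℕ.* M
  N₁ M = suc (2 ℕ.* M)

  qbinTerm : ℤ → ℕ → ℤ → ℚ
  qbinTerm e N i = q ^ℤ e * qbinℤ q N i

  termA termB termZ termU termW : ℕ → ℤ → ℚ
  termA = signedθ q σ ε
  termB M t = σ ^ℤ t * (qbinTerm (e₀ t) (N₁ M) (idx M (+ 0) t) + ε * qbinTerm (e₁ t) (N₁ M) (idx M (+ 2) t))
  termZ M t = σ ^ℤ t * qbinTerm (eZ t) (N₁ M) (idx M (+ 1) t)
  termU M t = σ ^ℤ t * qbinTerm (eU t) (N₀ M) (idx M -[1+ 0 ] t)
  termW M t = σ ^ℤ t * qbinTerm (eW t) (N₀ M) (idx M (+ 2) t)

  qbinTerm-cong : ∀ {e e′ i i′} N → e ≡ e′ → i ≡ i′ → qbinTerm e N i ≡ qbinTerm e′ N i′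
  qbinTerm-cong N refl refl = refl

  qbinTerm-shift : ∀ M e N i → qbinTerm (+ suc M ℤ.+ e) N i ≡ q ^ℕ suc M * qbinTerm e N i
  qbinTerm-shift M e N i =
    trans (cong (_* qbinℤ q N i) (^ℤ-homo-+ q q≢0 (+ suc M) e)) (*-assoc (q ^ℕ suc M) (q ^ℤ e) (qbinℤ q N i))

  qbinTerm-pascal : ∀ e N i → qbinTerm e (suc N) i ≡ qbinTerm e N (i ℤ.- ℤ.1ℤ) + qbinTerm (e ℤ.+ i) N i
  qbinTerm-pascal e N i = begin
    q ^ℤ e * qbinℤ q (suc N) i                                          ≡⟨ cong (q ^ℤ e *_) (qbinℤ-pascal q N i) ⟩
    q ^ℤ e * (qbinℤ q N (i ℤ.- ℤ.1ℤ) + q ^ℤ i * qbinℤ q N i)            ≡⟨ distribute (q ^ℤ e) _ (q ^ℤ i) _ ⟩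
    q ^ℤ e * qbinℤ q N (i ℤ.- ℤ.1ℤ) + q ^ℤ e * q ^ℤ i * qbinℤ q N i    ≡⟨ cong (λ u → qbinTerm e N (i ℤ.- ℤ.1ℤ) + u * qbinℤ q N i) (sym (^ℤ-homo-+ q q≢0 e i)) ⟩
    q ^ℤ e * qbinℤ q N (i ℤ.- ℤ.1ℤ) + q ^ℤ (e ℤ.+ i) * qbinℤ q N i     ∎
    where
    open ≡-Reasoning
    distribute : ∀ a b c d → a * (b + c * d) ≡ a * b + a * c * d
    distribute = Solver.solve-∀ ℚ-ring

  qbinTerm-pascal′ : ∀ e N i →
    qbinTerm e (suc N) i ≡ qbinTerm e N i + qbinTerm (e ℤ.+ (+ suc N ℤ.- i)) N (i ℤ.- ℤ.1ℤ)
  qbinTerm-pascal′ e N i = begin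
    q ^ℤ e * qbinℤ q (suc N) i                                       ≡⟨ cong (q ^ℤ e *_) (qbinℤ-pascal′ q q-nru N i) ⟩
    q ^ℤ e * (qbinℤ q N i + q ^ℤ j * qbinℤ q N (i ℤ.- ℤ.1ℤ))         ≡⟨ distribute (q ^ℤ e) _ (q ^ℤ j) _ ⟩
    q ^ℤ e * qbinℤ q N i + q ^ℤ e * q ^ℤ j * qbinℤ q N (i ℤ.- ℤ.1ℤ)  ≡⟨ cong (λ u → qbinTerm e N i + u * qbinℤ q N (i ℤ.- ℤ.1ℤ)) (sym (^ℤ-homo-+ q q≢0 e j)) ⟩
    q ^ℤ e * qbinℤ q N i + q ^ℤ (e ℤ.+ j) * qbinℤ q N (i ℤ.- ℤ.1ℤ)   ∎
    where
    open ≡-Reasoning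
    j = + suc N ℤ.- i
    distribute : ∀ a b c d → a * (b + c * d) ≡ a * b + a * c * d
    distribute = Solver.solve-∀ ℚ-ring

  +N₁ : ∀ M → + N₁ M ≡ + 1 ℤ.+ + 2 ℤ.* + M
  +N₁ M = cong (λ z → + 1 ℤ.+ z) (ℤP.pos-* 2 M)

  -- Exponent and index identities are quantified over m : ℤ and used at m = + M, since the ring
  -- solver only abstracts over variables.
  termB-split : ∀ M t → termB M t ≡ termA M t + q ^ℕ suc M * (termU M t + ε * termW M t)
  termB-split M t = begin
    termB M t
      ≡⟨ cong₂ (λ u v → σ ^ℤ t * (u + ε * v)) (qbinTerm-pascal′ (e₀ t) (N₀ M) (idx M (+ 0) t)) (qbinTerm-pascal (e₁ t) (N₀ M) (idx M (+ 2) t)) ⟩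
    σ ^ℤ t * ((A₀ + qbinTerm (e₀ t ℤ.+ (+ N₁ M ℤ.- idx M (+ 0) t)) (N₀ M) (idx M (+ 0) t ℤ.- ℤ.1ℤ))
              + ε * (qbinTerm (e₁ t) (N₀ M) (idx M (+ 2) t ℤ.- ℤ.1ℤ) + qbinTerm (e₁ t ℤ.+ idx M (+ 2) t) (N₀ M) (idx M (+ 2) t)))
      ≡⟨ cong₃ (λ u v w → σ ^ℤ t * ((A₀ + u) + ε * (v + w)))
               (trans (qbinTerm-cong (N₀ M) (trans (cong (λ n → e₀ t ℤ.+ (n ℤ.- idx M (+ 0) t)) (+N₁ M)) (exponentU (+ M) t)) (indexU (+ M) t))
                      (qbinTerm-shift M (eU t) (N₀ M) (idx M -[1+ 0 ] t)))
               (cong (qbinTerm (e₁ t) (N₀ M)) (index₁ (+ M) t))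
               (trans (cong (λ e → qbinTerm e (N₀ M) (idx M (+ 2) t)) (exponentW (+ M) t)) (qbinTerm-shift M (eW t) (N₀ M) (idx M (+ 2) t))) ⟩
    σ ^ℤ t * ((A₀ + q ^ℕ suc M * U) + ε * (A₁ + q ^ℕ suc M * W))
      ≡⟨ regroup (σ ^ℤ t) A₀ A₁ U W (q ^ℕ suc M) ε ⟩
    termA M t + q ^ℕ suc M * (termU M t + ε * termW M t) ∎
    where
    open ≡-Reasoning
    A₀ = qbinTerm (e₀ t) (N₀ M) (idx M (+ 0) t)
    A₁ = qbinTerm (e₁ t) (N₀ M) (idx M (+ 1) t)
    U = qbinTerm (eU t) (N₀ M) (idx M -[1+ 0 ] t)
    W = qbinTerm (eW t) (N₀ M) (idx M (+ 2) t)
    exponentU : ∀ m t → (+ 6 ℤ.* t ℤ.* t ℤ.- t) ℤ.+ ((+ 1 ℤ.+ + 2 ℤ.* m) ℤ.- (m ℤ.+ (+ 3 ℤ.* t ℤ.+ + 0)))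
                      ≡ (+ 1 ℤ.+ m) ℤ.+ (+ 6 ℤ.* t ℤ.* t ℤ.- + 4 ℤ.* t)
    exponentU = ZS.solve-∀
    indexU : ∀ m t → (m ℤ.+ (+ 3 ℤ.* t ℤ.+ + 0)) ℤ.- ℤ.1ℤ ≡ m ℤ.+ (+ 3 ℤ.* t ℤ.+ -[1+ 0 ])
    indexU = ZS.solve-∀
    index₁ : ∀ m t → (m ℤ.+ (+ 3 ℤ.* t ℤ.+ + 2)) ℤ.- ℤ.1ℤ ≡ m ℤ.+ (+ 3 ℤ.* t ℤ.+ + 1)
    index₁ = ZS.solve-∀
    exponentW : ∀ m t → (+ 6 ℤ.* t ℤ.* t ℤ.+ + 5 ℤ.* t ℤ.+ + 1) ℤ.+ (m ℤ.+ (+ 3 ℤ.* t ℤ.+ + 2))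
                      ≡ (+ 1 ℤ.+ m) ℤ.+ (+ 6 ℤ.* t ℤ.* t ℤ.+ + 8 ℤ.* t ℤ.+ + 2)
    exponentW = ZS.solve-∀
    regroup : ∀ s A₀ A₁ U W c ε → s * ((A₀ + c * U) + ε * (A₁ + c * W)) ≡ s * (A₀ + ε * A₁) + c * (s * U + ε * (s * W))
    regroup = Solver.solve-∀ ℚ-ring

  termU-shift : ∀ M t → termU M (t ℤ.+ ℤ.1ℤ) ≡ σ * termW M t
  termU-shift M t = begin
    σ ^ℤ (t ℤ.+ ℤ.1ℤ) * qbinTerm (eU (t ℤ.+ ℤ.1ℤ)) (N₀ M) (idx M -[1+ 0 ] (t ℤ.+ ℤ.1ℤ))
      ≡⟨ cong₂ _*_ (trans (^ℤ-homo-+ σ σ≢0 t ℤ.1ℤ) (cong (σ ^ℤ t *_) (*-identityʳ σ)))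
                   (qbinTerm-cong (N₀ M) (exponent t) (index (+ M) t)) ⟩
    σ ^ℤ t * σ * qbinTerm (eW t) (N₀ M) (idx M (+ 2) t)
      ≡⟨ xy∙z≈y∙xz (σ ^ℤ t) σ _ ⟩
    σ * termW M t ∎
    where
    open ≡-Reasoning
    exponent : ∀ t → (+ 6 ℤ.* (t ℤ.+ ℤ.1ℤ) ℤ.* (t ℤ.+ ℤ.1ℤ) ℤ.- + 4 ℤ.* (t ℤ.+ ℤ.1ℤ)) ≡ + 6 ℤ.* t ℤ.* t ℤ.+ + 8 ℤ.* t ℤ.+ + 2
    exponent = ZS.solve-∀
    index : ∀ m t → m ℤ.+ (+ 3 ℤ.* (t ℤ.+ ℤ.1ℤ) ℤ.+ -[1+ 0 ]) ≡ m ℤ.+ (+ 3 ℤ.* t ℤ.+ + 2)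
    index = ZS.solve-∀

  N₀-suc : ∀ M → N₀ (suc M) ≡ suc (N₁ M)
  N₀-suc M = cong suc (ℕP.+-suc M (M ℕ.+ 0))

  termA-step : ∀ M t → termA (suc M) t ≡ termB M t + (1ℚ + ε) * q ^ℕ suc M * termZ M t
  termA-step M t = begin
    termA (suc M) t
      ≡⟨ cong (λ n → σ ^ℤ t * (qbinTerm (e₀ t) n i₀′ + ε * qbinTerm (e₁ t) n i₁′)) (N₀-suc M) ⟩
    σ ^ℤ t * (qbinTerm (e₀ t) (suc (N₁ M)) i₀′ + ε * qbinTerm (e₁ t) (suc (N₁ M)) i₁′)
      ≡⟨ cong₂ (λ u v → σ ^ℤ t * (u + ε * v)) (qbinTerm-pascal (e₀ t) (N₁ M) i₀′) (qbinTerm-pascal′ (e₁ t) (N₁ M) i₁′) ⟩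
    σ ^ℤ t * ((qbinTerm (e₀ t) (N₁ M) (i₀′ ℤ.- ℤ.1ℤ) + qbinTerm (e₀ t ℤ.+ i₀′) (N₁ M) i₀′)
              + ε * (qbinTerm (e₁ t) (N₁ M) i₁′ + qbinTerm (e₁ t ℤ.+ (+ suc (N₁ M) ℤ.- i₁′)) (N₁ M) (i₁′ ℤ.- ℤ.1ℤ)))
      ≡⟨ cong₄ (λ a b c d → σ ^ℤ t * ((a + b) + ε * (c + d)))
               (cong (qbinTerm (e₀ t) (N₁ M)) (index₀ (+ M) t))
               (trans (qbinTerm-cong (N₁ M) (exponent₀ (+ M) t) (index₁ (+ M) t)) (qbinTerm-shift M (eZ t) (N₁ M) (idx M (+ 1) t)))
               (cong (qbinTerm (e₁ t) (N₁ M)) (index₂ (+ M) t))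
               (trans (qbinTerm-cong (N₁ M) (trans (cong (λ n → e₁ t ℤ.+ (+ 1 ℤ.+ n ℤ.- i₁′)) (+N₁ M)) (exponent₁ (+ M) t)) (index₁′ (+ M) t))
                      (qbinTerm-shift M (eZ t) (N₁ M) (idx M (+ 1) t))) ⟩
    σ ^ℤ t * ((B₀ + q ^ℕ suc M * Z) + ε * (B₂ + q ^ℕ suc M * Z))
      ≡⟨ regroup (σ ^ℤ t) B₀ B₂ Z (q ^ℕ suc M) ε ⟩
    termB M t + (1ℚ + ε) * q ^ℕ suc M * termZ M t ∎
    where
    open ≡-Reasoning
    i₀′ = idx (suc M) (+ 0) t
    i₁′ = idx (suc M) (+ 1) t
    B₀ = qbinTerm (e₀ t) (N₁ M) (idx M (+ 0) t)
    B₂ = qbinTerm (e₁ t) (N₁ M) (idx M (+ 2) t)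
    Z = qbinTerm (eZ t) (N₁ M) (idx M (+ 1) t)
    index₀ : ∀ m t → ((+ 1 ℤ.+ m) ℤ.+ (+ 3 ℤ.* t ℤ.+ + 0)) ℤ.- ℤ.1ℤ ≡ m ℤ.+ (+ 3 ℤ.* t ℤ.+ + 0)
    index₀ = ZS.solve-∀
    index₁ : ∀ m t → (+ 1 ℤ.+ m) ℤ.+ (+ 3 ℤ.* t ℤ.+ + 0) ≡ m ℤ.+ (+ 3 ℤ.* t ℤ.+ + 1)
    index₁ = ZS.solve-∀
    index₂ : ∀ m t → (+ 1 ℤ.+ m) ℤ.+ (+ 3 ℤ.* t ℤ.+ + 1) ≡ m ℤ.+ (+ 3 ℤ.* t ℤ.+ + 2)
    index₂ = ZS.solve-∀
    index₁′ : ∀ m t → ((+ 1 ℤ.+ m) ℤ.+ (+ 3 ℤ.* t ℤ.+ + 1)) ℤ.- ℤ.1ℤ ≡ m ℤ.+ (+ 3 ℤ.* t ℤ.+ + 1)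
    index₁′ = ZS.solve-∀
    exponent₀ : ∀ m t → (+ 6 ℤ.* t ℤ.* t ℤ.- t) ℤ.+ ((+ 1 ℤ.+ m) ℤ.+ (+ 3 ℤ.* t ℤ.+ + 0))
                      ≡ (+ 1 ℤ.+ m) ℤ.+ (+ 6 ℤ.* t ℤ.* t ℤ.+ + 2 ℤ.* t)
    exponent₀ = ZS.solve-∀
    exponent₁ : ∀ m t → (+ 6 ℤ.* t ℤ.* t ℤ.+ + 5 ℤ.* t ℤ.+ + 1) ℤ.+ (+ 1 ℤ.+ (+ 1 ℤ.+ + 2 ℤ.* m) ℤ.- ((+ 1 ℤ.+ m) ℤ.+ (+ 3 ℤ.* t ℤ.+ + 1)))
                      ≡ (+ 1 ℤ.+ m) ℤ.+ (+ 6 ℤ.* t ℤ.* t ℤ.+ + 2 ℤ.* t)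
    exponent₁ = ZS.solve-∀
    regroup : ∀ s B₀ B₂ Z c ε → s * ((B₀ + c * Z) + ε * (B₂ + c * Z)) ≡ s * (B₀ + ε * B₂) + (1ℚ + ε) * c * (s * Z)
    regroup = Solver.solve-∀ ℚ-ring

  termZ-step : ε ≡ 1ℚ → ∀ M t →
    termZ (suc M) t ≡ (1ℚ + q ^ℕ suc M * q ^ℕ suc M) * termZ M t + q ^ℕ suc M * termB M t
  termZ-step refl M t = begin
    termZ (suc M) t
      ≡⟨ cong (λ n → σ ^ℤ t * qbinTerm (eZ t) n i) (cong suc (N₀-suc M)) ⟩
    σ ^ℤ t * qbinTerm (eZ t) (suc (suc (N₁ M))) i
      ≡⟨ cong (σ ^ℤ t *_) (trans (qbinTerm-pascal (eZ t) (suc (N₁ M)) i)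
                                 (cong₂ _+_ (qbinTerm-pascal′ (eZ t) (N₁ M) (i ℤ.- ℤ.1ℤ)) (qbinTerm-pascal′ (eZ t ℤ.+ i) (N₁ M) i))) ⟩
    σ ^ℤ t * ((qbinTerm (eZ t) (N₁ M) (i ℤ.- ℤ.1ℤ) + qbinTerm (eZ t ℤ.+ (+ suc (N₁ M) ℤ.- (i ℤ.- ℤ.1ℤ))) (N₁ M) (i ℤ.- ℤ.1ℤ ℤ.- ℤ.1ℤ))
              + (qbinTerm (eZ t ℤ.+ i) (N₁ M) i + qbinTerm (eZ t ℤ.+ i ℤ.+ (+ suc (N₁ M) ℤ.- i)) (N₁ M) (i ℤ.- ℤ.1ℤ)))
      ≡⟨ cong₄ (λ a b c d → σ ^ℤ t * ((a + b) + (c + d)))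
               (cong (qbinTerm (eZ t) (N₁ M)) (index₁ (+ M) t))
               (trans (qbinTerm-cong (N₁ M) (trans (cong (λ n → eZ t ℤ.+ (+ 1 ℤ.+ n ℤ.- (i ℤ.- ℤ.1ℤ))) (+N₁ M)) (exponent₀ (+ M) t)) (index₀ (+ M) t))
                      (qbinTerm-shift M (e₀ t) (N₁ M) (idx M (+ 0) t)))
               (trans (qbinTerm-cong (N₁ M) (exponent₂ (+ M) t) (index₂ (+ M) t)) (qbinTerm-shift M (e₁ t) (N₁ M) (idx M (+ 2) t)))
               (trans (qbinTerm-cong (N₁ M) (trans (cong (λ n → eZ t ℤ.+ i ℤ.+ (+ 1 ℤ.+ n ℤ.- i)) (+N₁ M)) (exponentZ (+ M) t)) (index₁ (+ M) t))
                      (trans (qbinTerm-shift M (+ suc M ℤ.+ eZ t) (N₁ M) (idx M (+ 1) t)) (cong (q ^ℕ suc M *_) (qbinTerm-shift M (eZ t) (N₁ M) (idx M (+ 1) t))))) ⟩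
    σ ^ℤ t * ((Z + c * B₀) + (c * B₂ + c * (c * Z)))
      ≡⟨ regroup (σ ^ℤ t) B₀ B₂ Z c ⟩
    (1ℚ + c * c) * termZ M t + c * termB M t ∎
    where
    open ≡-Reasoning
    i = idx (suc M) (+ 1) t
    c = q ^ℕ suc M
    B₀ = qbinTerm (e₀ t) (N₁ M) (idx M (+ 0) t)
    B₂ = qbinTerm (e₁ t) (N₁ M) (idx M (+ 2) t)
    Z = qbinTerm (eZ t) (N₁ M) (idx M (+ 1) t)
    index₀ : ∀ m t → ((+ 1 ℤ.+ m) ℤ.+ (+ 3 ℤ.* t ℤ.+ + 1)) ℤ.- ℤ.1ℤ ℤ.- ℤ.1ℤ ≡ m ℤ.+ (+ 3 ℤ.* t ℤ.+ + 0)
    index₀ = ZS.solve-∀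
    index₁ : ∀ m t → ((+ 1 ℤ.+ m) ℤ.+ (+ 3 ℤ.* t ℤ.+ + 1)) ℤ.- ℤ.1ℤ ≡ m ℤ.+ (+ 3 ℤ.* t ℤ.+ + 1)
    index₁ = ZS.solve-∀
    index₂ : ∀ m t → (+ 1 ℤ.+ m) ℤ.+ (+ 3 ℤ.* t ℤ.+ + 1) ≡ m ℤ.+ (+ 3 ℤ.* t ℤ.+ + 2)
    index₂ = ZS.solve-∀
    exponent₀ : ∀ m t → (+ 6 ℤ.* t ℤ.* t ℤ.+ + 2 ℤ.* t) ℤ.+ (+ 1 ℤ.+ (+ 1 ℤ.+ + 2 ℤ.* m) ℤ.- (((+ 1 ℤ.+ m) ℤ.+ (+ 3 ℤ.* t ℤ.+ + 1)) ℤ.- ℤ.1ℤ))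
                      ≡ (+ 1 ℤ.+ m) ℤ.+ (+ 6 ℤ.* t ℤ.* t ℤ.- t)
    exponent₀ = ZS.solve-∀
    exponent₂ : ∀ m t → (+ 6 ℤ.* t ℤ.* t ℤ.+ + 2 ℤ.* t) ℤ.+ ((+ 1 ℤ.+ m) ℤ.+ (+ 3 ℤ.* t ℤ.+ + 1))
                      ≡ (+ 1 ℤ.+ m) ℤ.+ (+ 6 ℤ.* t ℤ.* t ℤ.+ + 5 ℤ.* t ℤ.+ + 1)
    exponent₂ = ZS.solve-∀
    exponentZ : ∀ m t → (+ 6 ℤ.* t ℤ.* t ℤ.+ + 2 ℤ.* t) ℤ.+ ((+ 1 ℤ.+ m) ℤ.+ (+ 3 ℤ.* t ℤ.+ + 1))
                          ℤ.+ (+ 1 ℤ.+ (+ 1 ℤ.+ + 2 ℤ.* m) ℤ.- ((+ 1 ℤ.+ m) ℤ.+ (+ 3 ℤ.* t ℤ.+ + 1)))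
                      ≡ (+ 1 ℤ.+ m) ℤ.+ ((+ 1 ℤ.+ m) ℤ.+ (+ 6 ℤ.* t ℤ.* t ℤ.+ + 2 ℤ.* t))
    exponentZ = ZS.solve-∀
    regroup : ∀ s B₀ B₂ Z c → s * ((Z + c * B₀) + (c * B₂ + c * (c * Z))) ≡ (1ℚ + c * c) * (s * Z) + c * (s * (B₀ + 1ℚ * B₂))
    regroup = Solver.solve-∀ ℚ-ring

  termZ-supported : ∀ M → Supported M (termZ M)
  termZ-supported M =
    supported-* (σ ^ℤ_) (supported-* (λ t → q ^ℤ eZ t) (qbinℤ-idx-supported q M (N₁ M) 1 ℕP.≤-refl (ℕ.s≤s ℕ.z≤n)))

  termU-supported : ∀ M → Supported M (termU M)
  termU-supported M =
    supported-* (σ ^ℤ_) (supported-* (λ t → q ^ℤ eU t) (qbinℤ-idx-1-supported q M (N₀ M) (ℕP.n≤1+n _)))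

  ΣA ΣB ΣZ ΣU ΣW : ℕ → ℚ
  ΣA M = sumSym (suc M) (termA M)
  ΣB M = sumSym (suc M) (termB M)
  ΣZ M = sumSym (suc M) (termZ M)
  ΣU M = sumSym (suc M) (termU M)
  ΣW M = sumSym (suc M) (termW M)

  ΣU≡σΣW : ∀ M → ΣU M ≡ σ * ΣW M
  ΣU≡σΣW M = begin
    ΣU M
      ≡⟨ sym (trans (cong₂ (λ u v → ΣU M - u + v) U₋≡0 U₊≡0) (minus-plus-0 (ΣU M))) ⟩
    ΣU M - termU M (ℤ.- (+ suc M)) + termU M (+ suc (suc M))
      ≡⟨ sym (sumSym-shift (suc M) (termU M)) ⟩
    sumSym (suc M) (λ t → termU M (t ℤ.+ ℤ.1ℤ))
      ≡⟨ sumSym-cong (suc M) (termU-shift M) ⟩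
    sumSym (suc M) (λ t → σ * termW M t)
      ≡⟨ sumSym-* (suc M) σ (termW M) ⟩
    σ * ΣW M ∎
    where
    open ≡-Reasoning
    U₋≡0 : termU M (ℤ.- (+ suc M)) ≡ 0ℚ
    U₋≡0 = trans (cong (λ k → termU M -[1+ k ]) (sym (ℕP.+-identityʳ M))) (vanishes⁻ (termU-supported M) 0)
    U₊≡0 : termU M (+ suc (suc M)) ≡ 0ℚ
    U₊≡0 = trans (cong (λ k → termU M (+ suc k)) (ℕP.+-comm 1 M)) (vanishes⁺ (termU-supported M) 1)
    minus-plus-0 : ∀ a → a - 0ℚ + 0ℚ ≡ a
    minus-plus-0 = Solver.solve-∀ ℚ-ring

  ΣB≡ΣA : σ + ε ≡ 0ℚ → ∀ M → ΣB M ≡ ΣA M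
  ΣB≡ΣA σ+ε≡0 M = begin
    ΣB M
      ≡⟨ sumSym-cong (suc M) (termB-split M) ⟩
    sumSym (suc M) (λ t → termA M t + q ^ℕ suc M * (termU M t + ε * termW M t))
      ≡⟨ trans (sumSym-plus (suc M) _ _) (cong (λ u → ΣA M + u) (trans (sumSym-* (suc M) (q ^ℕ suc M) _)
           (cong (q ^ℕ suc M *_) (trans (sumSym-plus (suc M) _ _) (cong (λ u → ΣU M + u) (sumSym-* (suc M) ε _)))))) ⟩
    ΣA M + q ^ℕ suc M * (ΣU M + ε * ΣW M)
      ≡⟨ cong (λ u → ΣA M + q ^ℕ suc M * (u + ε * ΣW M)) (ΣU≡σΣW M) ⟩
    ΣA M + q ^ℕ suc M * (σ * ΣW M + ε * ΣW M)
      ≡⟨ cong (λ u → ΣA M + q ^ℕ suc M * u) (trans (sym (*-distribʳ-+ (ΣW M) σ ε)) (cong (_* ΣW M) σ+ε≡0)) ⟩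
    ΣA M + q ^ℕ suc M * (0ℚ * ΣW M)
      ≡⟨ vanish (ΣA M) (q ^ℕ suc M) (ΣW M) ⟩
    ΣA M ∎
    where
    open ≡-Reasoning
    vanish : ∀ a b c → a + b * (0ℚ * c) ≡ a
    vanish = Solver.solve-∀ ℚ-ring

  ΣA-step : ∀ M → ΣA (suc M) ≡ ΣB M + (1ℚ + ε) * q ^ℕ suc M * ΣZ M
  ΣA-step M = begin
    ΣA (suc M)
      ≡⟨ sumSym-stable (signedθ-supported q σ ε (suc M)) (ℕP.n≤1+n (suc M)) ℕP.≤-refl ⟩
    sumSym (suc M) (termA (suc M))
      ≡⟨ sumSym-cong (suc M) (termA-step M) ⟩
    sumSym (suc M) (λ t → termB M t + (1ℚ + ε) * q ^ℕ suc M * termZ M t)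
      ≡⟨ trans (sumSym-plus (suc M) _ _) (cong (λ u → ΣB M + u) (sumSym-* (suc M) ((1ℚ + ε) * q ^ℕ suc M) (termZ M))) ⟩
    ΣB M + (1ℚ + ε) * q ^ℕ suc M * ΣZ M ∎
    where open ≡-Reasoning

  ΣZ-step : ε ≡ 1ℚ → ∀ M → ΣZ (suc M) ≡ (1ℚ + q ^ℕ suc M * q ^ℕ suc M) * ΣZ M + q ^ℕ suc M * ΣB M
  ΣZ-step ε≡1 M = begin
    ΣZ (suc M)
      ≡⟨ sumSym-stable (termZ-supported (suc M)) (ℕP.n≤1+n (suc M)) ℕP.≤-refl ⟩
    sumSym (suc M) (termZ (suc M))
      ≡⟨ sumSym-cong (suc M) (termZ-step ε≡1 M) ⟩
    sumSym (suc M) (λ t → c * termZ M t + q ^ℕ suc M * termB M t)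
      ≡⟨ trans (sumSym-plus (suc M) (λ t → c * termZ M t) _) (cong₂ _+_ (sumSym-* (suc M) c (termZ M)) (sumSym-* (suc M) (q ^ℕ suc M) (termB M))) ⟩
    c * ΣZ M + q ^ℕ suc M * ΣB M ∎
    where
    open ≡-Reasoning
    c = 1ℚ + q ^ℕ suc M * q ^ℕ suc M

  ΣA-0 : ΣA 0 ≡ 1ℚ
  ΣA-0 = trans (sumSym-stable {φ = termA 0} (signedθ-supported q σ ε 0) (ℕ.z≤n {1}) (ℕ.z≤n {0})) (value q ε)
    where
    value : ∀ q ε → 1ℚ * (1ℚ * 1ℚ + ε * ((q * 1ℚ) * 0ℚ)) ≡ 1ℚ
    value = Solver.solve-∀ ℚ-ring

  ΣZ-0 : ΣZ 0 ≡ 1ℚ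
  ΣZ-0 = trans (sumSym-stable {φ = termZ 0} (termZ-supported 0) (ℕ.z≤n {1}) (ℕ.z≤n {0})) (value q)
    where
    value : ∀ q → 1ℚ * (1ℚ * (1ℚ + (q * 1ℚ) * 0ℚ)) ≡ 1ℚ
    value = Solver.solve-∀ ℚ-ring

-- Both sides satisfy the same recurrences

-- For σ = -1, ε = 1 the pair (ΣA M, ΣZ M) obeys the recurrences F-step, F-step-q of (F M 1, F M q),
-- since ΣB = ΣA.  For σ = 1, ε = -1 the factor 1 + ε kills the step, as 1 + w does in F M (-1).
module Comparison (q : ℚ) (q≢0 : q ≢ 0ℚ) (q-nru : NonRootOfUnity q) (q²-nru : NonRootOfUnity (q * q)) where
  open LeftSide q q²-nru
  module Sum        = RightSide q q≢0 q-nru (- 1ℚ) 1ℚ (λ ())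
  module Difference = RightSide q q≢0 q-nru 1ℚ (- 1ℚ) (λ ())

  F≡ΣA×F≡ΣZ : ∀ M → (F M 1ℚ ≡ Sum.ΣA M) × (F M q ≡ Sum.ΣZ M)
  F≡ΣA×F≡ΣZ zero = sym Sum.ΣA-0 , sym Sum.ΣZ-0
  F≡ΣA×F≡ΣZ (suc M) with F≡ΣA×F≡ΣZ M
  ... | F1≡ΣA , Fq≡ΣZ = F1≡ΣA′ , Fq≡ΣZ′
    where
    open ≡-Reasoning
    a = q ^ℕ suc M
    F1≡ΣB : F M 1ℚ ≡ Sum.ΣB M
    F1≡ΣB = trans F1≡ΣA (sym (Sum.ΣB≡ΣA refl M))
    F1≡ΣA′ : F (suc M) 1ℚ ≡ Sum.ΣA (suc M)
    F1≡ΣA′ = begin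
      F (suc M) 1ℚ                              ≡⟨ F-step M 1ℚ ⟩
      F M 1ℚ + (1ℚ + 1ℚ) * a * F M (1ℚ * q)     ≡⟨ cong₂ (λ u v → u + (1ℚ + 1ℚ) * a * v) F1≡ΣB (trans (cong (F M) (*-identityˡ q)) Fq≡ΣZ) ⟩
      Sum.ΣB M + (1ℚ + 1ℚ) * a * Sum.ΣZ M       ≡⟨ sym (Sum.ΣA-step M) ⟩
      Sum.ΣA (suc M)                            ∎
    Fq≡ΣZ′ : F (suc M) q ≡ Sum.ΣZ (suc M)
    Fq≡ΣZ′ = begin
      F (suc M) q                               ≡⟨ F-step-q M ⟩
      (1ℚ + a * a) * F M q + a * F M 1ℚ         ≡⟨ cong₂ (λ u v → (1ℚ + a * a) * u + a * v) Fq≡ΣZ F1≡ΣB ⟩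
      (1ℚ + a * a) * Sum.ΣZ M + a * Sum.ΣB M    ≡⟨ sym (Sum.ΣZ-step refl M) ⟩
      Sum.ΣZ (suc M)                            ∎

  ΣA≡1 : ∀ M → Difference.ΣA M ≡ 1ℚ
  ΣA≡1 zero    = Difference.ΣA-0
  ΣA≡1 (suc M) = begin
    Difference.ΣA (suc M)
      ≡⟨ Difference.ΣA-step M ⟩
    Difference.ΣB M + (1ℚ + - 1ℚ) * q ^ℕ suc M * Difference.ΣZ M
      ≡⟨ cong (λ u → u + (1ℚ + - 1ℚ) * q ^ℕ suc M * Difference.ΣZ M) (trans (Difference.ΣB≡ΣA refl M) (ΣA≡1 M)) ⟩
    1ℚ + 0ℚ * q ^ℕ suc M * Difference.ΣZ M
      ≡⟨ vanish (q ^ℕ suc M) (Difference.ΣZ M) ⟩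
    1ℚ ∎
    where
    open ≡-Reasoning
    vanish : ∀ a b → 1ℚ + 0ℚ * a * b ≡ 1ℚ
    vanish = Solver.solve-∀ ℚ-ring

module LeftSideOfTheorem (q : ℚ) (q-nru : NonRootOfUnity q) (q²-nru : NonRootOfUnity (q * q)) where
  open LeftSide q q²-nru

  qpoch-q²≡qpoch*negQPoch : ∀ n → poch (q * q) (q * q) n ≡ qpoch q n * negQPoch n
  qpoch-q²≡qpoch*negQPoch zero    = refl
  qpoch-q²≡qpoch*negQPoch (suc n) = begin
    poch Q Q n * (1ℚ - Q * Q ^ℕ n)
      ≡⟨ cong₂ (λ u v → u * (1ℚ - Q * v)) (qpoch-q²≡qpoch*negQPoch n) (^ℕ-distrib-* q q n) ⟩
    qpoch q n * negQPoch n * (1ℚ - q * q * (q ^ℕ n * q ^ℕ n))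
      ≡⟨ difference-of-squares (qpoch q n) (negQPoch n) q (q ^ℕ n) ⟩
    qpoch q n * (1ℚ - q * q ^ℕ n) * (negQPoch n * (1ℚ + q * q ^ℕ n)) ∎
    where
    open ≡-Reasoning
    difference-of-squares : ∀ a b q x → a * b * (1ℚ - q * q * (x * x)) ≡ a * (1ℚ - q * x) * (b * (1ℚ + q * x))
    difference-of-squares = Solver.solve-∀ ℚ-ring

  summand : ℕ → ℕ → ℚ
  summand M r = q ^ℕ (r ℕ.* r) * poch (q * q) (q * q) M * inv (poch (q * q) (q * q) r) * recipQPoch q (+ M ℤ.- + r)

  summand≡coeff : ∀ M r → summand M r ≡ coeff M r
  summand≡coeff M r with ℕP.≤-<-connex r M
  ... | inj₁ r≤M with ℕP.m≤n⇒∃[o]m+o≡n r≤M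
  ...   | d , refl = begin
    q ^ℕ (r ℕ.* r) * poch Q Q (r ℕ.+ d) * inv (poch Q Q r) * recipQPoch q (+ (r ℕ.+ d) ℤ.- + r)
      ≡⟨ cong (λ z → q ^ℕ (r ℕ.* r) * poch Q Q (r ℕ.+ d) * inv (poch Q Q r) * recipQPoch q z) r+d-r≡d ⟩
    q ^ℕ (r ℕ.* r) * qpoch Q (r ℕ.+ d) * inv (qpoch Q r) * inv (qpoch q d)
      ≡⟨ cong (λ u → q ^ℕ (r ℕ.* r) * u * inv (qpoch Q r) * inv (qpoch q d))
              (trans (sym (qbin₂-*-qpoch Q r d)) (cong (λ u → qbin₂ Q r d * (qpoch Q r * u)) (qpoch-q²≡qpoch*negQPoch d))) ⟩
    q ^ℕ (r ℕ.* r) * (qbin₂ Q r d * (qpoch Q r * (qpoch q d * negQPoch d))) * inv (qpoch Q r) * inv (qpoch q d)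
      ≡⟨ regroup (q ^ℕ (r ℕ.* r)) (qbin₂ Q r d) (qpoch Q r) (qpoch q d) (negQPoch d) (inv (qpoch Q r)) (inv (qpoch q d)) ⟩
    q ^ℕ (r ℕ.* r) * qbin₂ Q r d * negQPoch d * (qpoch Q r * inv (qpoch Q r)) * (qpoch q d * inv (qpoch q d))
      ≡⟨ cong₂ (λ u v → q ^ℕ (r ℕ.* r) * qbin₂ Q r d * negQPoch d * u * v)
               (inv-inverseʳ _ (qpoch-≢0 Q q²-nru r)) (inv-inverseʳ _ (qpoch-≢0 q q-nru d)) ⟩
    q ^ℕ (r ℕ.* r) * qbin₂ Q r d * negQPoch d * 1ℚ * 1ℚ
      ≡⟨ trans (*-identityʳ _) (*-identityʳ _) ⟩
    q ^ℕ (r ℕ.* r) * qbin₂ Q r d * negQPoch d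
      ≡⟨ cong (λ n → q ^ℕ (r ℕ.* r) * qbin₂ Q r d * negQPoch n) (sym (ℕP.m+n∸m≡n r d)) ⟩
    coeff (r ℕ.+ d) r ∎
    where
    open ≡-Reasoning
    r+d-r≡d : + (r ℕ.+ d) ℤ.- + r ≡ + d
    r+d-r≡d = trans (ℤP.m-n≡m⊖n (r ℕ.+ d) r) (trans (ℤP.⊖-≥ r≤M) (cong +_ (ℕP.m+n∸m≡n r d)))
    regroup : ∀ a b c d e c⁻¹ d⁻¹ → a * (b * (c * (d * e))) * c⁻¹ * d⁻¹ ≡ a * b * e * (c * c⁻¹) * (d * d⁻¹)
    regroup = Solver.solve-∀ ℚ-ring
  summand≡coeff M r | inj₂ M<r = trans (summand-neg M-r≡-[1+r∸M∸1]) (sym (coeff-≡0 M r M<r))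
    where
    summand-neg : ∀ {j} → + M ℤ.- + r ≡ -[1+ j ] → summand M r ≡ 0ℚ
    summand-neg eq rewrite eq = *-zeroʳ (q ^ℕ (r ℕ.* r) * poch (q * q) (q * q) M * inv (poch (q * q) (q * q) r))
    M-r≡-[1+r∸M∸1] : + M ℤ.- + r ≡ -[1+ (r ℕ.∸ suc M) ]
    M-r≡-[1+r∸M∸1] = trans (ℤP.m-n≡m⊖n M r) (trans (ℤP.⊖-< M<r) (cong (λ u → ℤ.- (+ u)) (ℕP.+-∸-assoc 1 M<r)))

  lhsTerm-guard : ∀ {b b′ : ℕ} a M r → b ≡ b′ →
    (if b ℕ.≡ᵇ a then summand M r else 0ℚ) ≡ (if b′ ℕ.≡ᵇ a then summand M r else 0ℚ)
  lhsTerm-guard a M r refl = refl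

  lhsTerm-plus : ∀ M r → lhsTerm q 0 M r + lhsTerm q 1 M r ≡ summand M r
  lhsTerm-plus M r with parity r
  ... | inj₁ (r%2≡0 , _) = trans (cong₂ _+_ (lhsTerm-guard 0 M r r%2≡0) (lhsTerm-guard 1 M r r%2≡0)) (+-identityʳ (summand M r))
  ... | inj₂ (r%2≡1 , _) = trans (cong₂ _+_ (lhsTerm-guard 0 M r r%2≡1) (lhsTerm-guard 1 M r r%2≡1)) (+-identityˡ (summand M r))

  lhsTerm-minus : ∀ M r → lhsTerm q 0 M r - lhsTerm q 1 M r ≡ (- 1ℚ) ^ℕ r * summand M r
  lhsTerm-minus M r with parity r
  ... | inj₁ (r%2≡0 , sign) = trans (cong₂ _-_ (lhsTerm-guard 0 M r r%2≡0) (lhsTerm-guard 1 M r r%2≡0))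
                                    (trans (minus-0 (summand M r)) (cong (_* summand M r) (sym sign)))
    where
    minus-0 : ∀ x → x - 0ℚ ≡ 1ℚ * x
    minus-0 = Solver.solve-∀ ℚ-ring
  ... | inj₂ (r%2≡1 , sign) = trans (cong₂ _-_ (lhsTerm-guard 0 M r r%2≡1) (lhsTerm-guard 1 M r r%2≡1))
                                    (trans (0-minus (summand M r)) (cong (_* summand M r) (sym sign)))
    where
    0-minus : ∀ x → 0ℚ - x ≡ - 1ℚ * x
    0-minus = Solver.solve-∀ ℚ-ring

  weighted-summand≡0 : ∀ M w r → suc M ℕ.≤ r → w ^ℕ r * summand M r ≡ 0ℚ
  weighted-summand≡0 M w r M<r = trans (cong (w ^ℕ r *_) (trans (summand≡coeff M r) (coeff-≡0 M r M<r))) (*-zeroʳ (w ^ℕ r))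

  sumBelow-weighted-summand : ∀ M w N → M ℕ.< N → sumBelow N (λ r → w ^ℕ r * summand M r) ≡ F M w
  sumBelow-weighted-summand M w N M<N = trans (sumBelow-stable (suc M) _ (weighted-summand≡0 M w) N M<N)
                                              (sumBelow-cong (suc M) (λ r → cong (w ^ℕ r *_) (summand≡coeff M r)))

  lhs-plus : ∀ M N → M ℕ.< N → sumBelow N (lhsTerm q 0 M) + sumBelow N (lhsTerm q 1 M) ≡ F M 1ℚ
  lhs-plus M N M<N = begin
    sumBelow N (lhsTerm q 0 M) + sumBelow N (lhsTerm q 1 M)   ≡⟨ sym (sumBelow-plus N _ _) ⟩
    sumBelow N (λ r → lhsTerm q 0 M r + lhsTerm q 1 M r)      ≡⟨ sumBelow-cong N (λ r → trans (lhsTerm-plus M r) (sym (unit (summand M r) (1^ℕ r)))) ⟩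
    sumBelow N (λ r → 1ℚ ^ℕ r * summand M r)                  ≡⟨ sumBelow-weighted-summand M 1ℚ N M<N ⟩
    F M 1ℚ                                                    ∎
    where
    open ≡-Reasoning
    unit : ∀ x {y} → y ≡ 1ℚ → y * x ≡ x
    unit x refl = *-identityˡ x

  lhs-minus : ∀ M N → M ℕ.< N → sumBelow N (lhsTerm q 0 M) - sumBelow N (lhsTerm q 1 M) ≡ F M (- 1ℚ)
  lhs-minus M N M<N = begin
    sumBelow N (lhsTerm q 0 M) - sumBelow N (lhsTerm q 1 M)   ≡⟨ sym (sumBelow-minus N _ _) ⟩
    sumBelow N (λ r → lhsTerm q 0 M r - lhsTerm q 1 M r)      ≡⟨ sumBelow-cong N (lhsTerm-minus M) ⟩
    sumBelow N (λ r → (- 1ℚ) ^ℕ r * summand M r)              ≡⟨ sumBelow-weighted-summand M (- 1ℚ) N M<N ⟩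
    F M (- 1ℚ)                                                ∎
    where open ≡-Reasoning

module RightSideOfTheorem (q : ℚ) (q-nru : NonRootOfUnity q) where

  rhsTerm₁-0≡θ₀ : ∀ M j → rhsTerm₁ q 0 M j ≡ θ₀ q M (ℤ.- (+ 2 ℤ.* j))
  rhsTerm₁-0≡θ₀ M j = cong₂ _*_ (cong (q ^ℤ_) (exponent j))
    (trans (gauss≡qbinℤ q q-nru (2 ℕ.* M) (+ M ℤ.- + 6 ℤ.* j ℤ.+ + 0)) (cong (qbinℤ q (2 ℕ.* M)) (index (+ M) j)))
    where
    exponent : ∀ j → + 24 ℤ.* j ℤ.* j ℤ.+ + 2 ℤ.* j ℤ.* (+ 1 ℤ.- + 6 ℤ.* + 0) ℤ.+ + 0
                   ≡ + 6 ℤ.* (ℤ.- (+ 2 ℤ.* j)) ℤ.* (ℤ.- (+ 2 ℤ.* j)) ℤ.- (ℤ.- (+ 2 ℤ.* j))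
    exponent = ZS.solve-∀
    index : ∀ m j → m ℤ.- + 6 ℤ.* j ℤ.+ + 0 ≡ m ℤ.+ (+ 3 ℤ.* (ℤ.- (+ 2 ℤ.* j)) ℤ.+ + 0)
    index = ZS.solve-∀

  rhsTerm₁-1≡θ₁ : ∀ M j → rhsTerm₁ q 1 M j ≡ θ₁ q M (ℤ.- (+ 2 ℤ.* j))
  rhsTerm₁-1≡θ₁ M j = cong₂ _*_ (cong (q ^ℤ_) (exponent j))
    (trans (gauss≡qbinℤ q q-nru (2 ℕ.* M) (+ M ℤ.- + 6 ℤ.* j ℤ.+ + 1)) (cong (qbinℤ q (2 ℕ.* M)) (index (+ M) j)))
    where
    exponent : ∀ j → + 24 ℤ.* j ℤ.* j ℤ.+ + 2 ℤ.* j ℤ.* (+ 1 ℤ.- + 6 ℤ.* + 1) ℤ.+ + 1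
                   ≡ + 6 ℤ.* (ℤ.- (+ 2 ℤ.* j)) ℤ.* (ℤ.- (+ 2 ℤ.* j)) ℤ.+ + 5 ℤ.* (ℤ.- (+ 2 ℤ.* j)) ℤ.+ + 1
    exponent = ZS.solve-∀
    index : ∀ m j → m ℤ.- + 6 ℤ.* j ℤ.+ + 1 ≡ m ℤ.+ (+ 3 ℤ.* (ℤ.- (+ 2 ℤ.* j)) ℤ.+ + 1)
    index = ZS.solve-∀

  -- Via the reflection [2M, k] = [2M, 2M - k], the subtracted sums become θ₁ and θ₀ at odd arguments.
  rhsTerm₂-0≡θ₁ : ∀ M j → rhsTerm₂ q 0 M j ≡ θ₁ q M (+ 2 ℤ.* j ℤ.- ℤ.1ℤ)
  rhsTerm₂-0≡θ₁ M j = cong₂ _*_ (cong (q ^ℤ_) (exponent j))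
    (trans (gauss≡qbinℤ q q-nru (2 ℕ.* M) k) (trans (qbinℤ-reflect q q-nru (2 ℕ.* M) k)
      (cong (qbinℤ q (2 ℕ.* M)) (trans (cong (ℤ._- k) (ℤP.pos-* 2 M)) (index (+ M) j)))))
    where
    k = + M ℤ.- + 6 ℤ.* j ℤ.+ + 0 ℤ.+ + 2
    exponent : ∀ j → + 24 ℤ.* j ℤ.* j ℤ.- + 2 ℤ.* j ℤ.* (+ 7 ℤ.+ + 6 ℤ.* + 0) ℤ.+ + 2 ℤ.+ + 5 ℤ.* + 0
                   ≡ + 6 ℤ.* (+ 2 ℤ.* j ℤ.- ℤ.1ℤ) ℤ.* (+ 2 ℤ.* j ℤ.- ℤ.1ℤ) ℤ.+ + 5 ℤ.* (+ 2 ℤ.* j ℤ.- ℤ.1ℤ) ℤ.+ + 1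
    exponent = ZS.solve-∀
    index : ∀ m j → + 2 ℤ.* m ℤ.- (m ℤ.- + 6 ℤ.* j ℤ.+ + 0 ℤ.+ + 2) ≡ m ℤ.+ (+ 3 ℤ.* (+ 2 ℤ.* j ℤ.- ℤ.1ℤ) ℤ.+ + 1)
    index = ZS.solve-∀

  rhsTerm₂-1≡θ₀ : ∀ M j → rhsTerm₂ q 1 M j ≡ θ₀ q M (+ 2 ℤ.* j ℤ.- ℤ.1ℤ)
  rhsTerm₂-1≡θ₀ M j = cong₂ _*_ (cong (q ^ℤ_) (exponent j))
    (trans (gauss≡qbinℤ q q-nru (2 ℕ.* M) k) (trans (qbinℤ-reflect q q-nru (2 ℕ.* M) k)
      (cong (qbinℤ q (2 ℕ.* M)) (trans (cong (ℤ._- k) (ℤP.pos-* 2 M)) (index (+ M) j)))))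
    where
    k = + M ℤ.- + 6 ℤ.* j ℤ.+ + 1 ℤ.+ + 2
    exponent : ∀ j → + 24 ℤ.* j ℤ.* j ℤ.- + 2 ℤ.* j ℤ.* (+ 7 ℤ.+ + 6 ℤ.* + 1) ℤ.+ + 2 ℤ.+ + 5 ℤ.* + 1
                   ≡ + 6 ℤ.* (+ 2 ℤ.* j ℤ.- ℤ.1ℤ) ℤ.* (+ 2 ℤ.* j ℤ.- ℤ.1ℤ) ℤ.- (+ 2 ℤ.* j ℤ.- ℤ.1ℤ)
    exponent = ZS.solve-∀
    index : ∀ m j → + 2 ℤ.* m ℤ.- (m ℤ.- + 6 ℤ.* j ℤ.+ + 1 ℤ.+ + 2) ≡ m ℤ.+ (+ 3 ℤ.* (+ 2 ℤ.* j ℤ.- ℤ.1ℤ) ℤ.+ + 0)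
    index = ZS.solve-∀

  rhs : ℕ → ℕ → ℕ → ℚ
  rhs a M N = sumSym N (rhsTerm₁ q a M) - sumSym N (rhsTerm₂ q a M)

  rhs-plus : ∀ M N → M ℕ.< N → rhs 0 M N + rhs 1 M N ≡ sumSym (suc M) (signedθ q (- 1ℚ) 1ℚ M)
  rhs-plus M N M<N = begin
    rhs 0 M N + rhs 1 M N
      ≡⟨ regroup (sumSym N (rhsTerm₁ q 0 M)) (sumSym N (rhsTerm₂ q 0 M)) (sumSym N (rhsTerm₁ q 1 M)) (sumSym N (rhsTerm₂ q 1 M)) ⟩
    (sumSym N (rhsTerm₁ q 0 M) + sumSym N (rhsTerm₁ q 1 M)) - (sumSym N (rhsTerm₂ q 0 M) + sumSym N (rhsTerm₂ q 1 M))
      ≡⟨ sym (cong₂ _-_ (sumSym-plus N (rhsTerm₁ q 0 M) (rhsTerm₁ q 1 M)) (sumSym-plus N (rhsTerm₂ q 0 M) (rhsTerm₂ q 1 M))) ⟩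
    sumSym N (λ j → rhsTerm₁ q 0 M j + rhsTerm₁ q 1 M j) - sumSym N (λ j → rhsTerm₂ q 0 M j + rhsTerm₂ q 1 M j)
      ≡⟨ cong₂ _-_ (trans (sumSym-cong N (λ j → cong₂ _+_ (rhsTerm₁-0≡θ₀ M j) (rhsTerm₁-1≡θ₁ M j))) (sumSym-neg-even N θ))
                   (sumSym-cong N (λ j → trans (cong₂ _+_ (rhsTerm₂-0≡θ₁ M j) (rhsTerm₂-1≡θ₀ M j)) (+-comm (θ₁ q M (+ 2 ℤ.* j ℤ.- ℤ.1ℤ)) (θ₀ q M (+ 2 ℤ.* j ℤ.- ℤ.1ℤ))))) ⟩
    sumSym N (λ j → θ (+ 2 ℤ.* j)) - sumSym N (λ j → θ (+ 2 ℤ.* j ℤ.- ℤ.1ℤ))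
      ≡⟨ sym (sumSym-minus N _ _) ⟩
    sumSym N (λ j → θ (+ 2 ℤ.* j) - θ (+ 2 ℤ.* j ℤ.- ℤ.1ℤ))
      ≡⟨ sumSym-cong N (λ j → cong₂ _+_ (sym (even j)) (sym (odd j))) ⟩
    sumSym N (λ j → g (+ 2 ℤ.* j) + g (+ 2 ℤ.* j ℤ.- ℤ.1ℤ))
      ≡⟨ sumSym-interleave (signedθ-supported q (- 1ℚ) 1ℚ M) (ℕP.<⇒≤ M<N) (ℕP.n≤1+n M) ⟩
    sumSym (suc M) g ∎
    where
    open ≡-Reasoning
    regroup : ∀ a b c d → (a - b) + (c - d) ≡ (a + c) - (b + d)
    regroup = Solver.solve-∀ ℚ-ring
    negate : ∀ x → - 1ℚ * x ≡ - x
    negate = Solver.solve-∀ ℚ-ring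
    θ g : ℤ → ℚ
    θ t = θ₀ q M t + θ₁ q M t
    g = signedθ q (- 1ℚ) 1ℚ M
    even : ∀ j → g (+ 2 ℤ.* j) ≡ θ (+ 2 ℤ.* j)
    even j = trans (cong₂ _*_ (-1^ℤ-even j) (cong (λ u → θ₀ q M (+ 2 ℤ.* j) + u) (*-identityˡ _))) (*-identityˡ _)
    odd : ∀ j → g (+ 2 ℤ.* j ℤ.- ℤ.1ℤ) ≡ - θ (+ 2 ℤ.* j ℤ.- ℤ.1ℤ)
    odd j = trans (cong₂ _*_ (-1^ℤ-odd j) (cong (λ u → θ₀ q M (+ 2 ℤ.* j ℤ.- ℤ.1ℤ) + u) (*-identityˡ _))) (negate _)

  rhs-minus : ∀ M N → M ℕ.< N → rhs 0 M N - rhs 1 M N ≡ sumSym (suc M) (signedθ q 1ℚ (- 1ℚ) M)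
  rhs-minus M N M<N = begin
    rhs 0 M N - rhs 1 M N
      ≡⟨ regroup (sumSym N (rhsTerm₁ q 0 M)) (sumSym N (rhsTerm₂ q 0 M)) (sumSym N (rhsTerm₁ q 1 M)) (sumSym N (rhsTerm₂ q 1 M)) ⟩
    (sumSym N (rhsTerm₁ q 0 M) - sumSym N (rhsTerm₁ q 1 M)) + (sumSym N (rhsTerm₂ q 1 M) - sumSym N (rhsTerm₂ q 0 M))
      ≡⟨ sym (cong₂ _+_ (sumSym-minus N (rhsTerm₁ q 0 M) (rhsTerm₁ q 1 M)) (sumSym-minus N (rhsTerm₂ q 1 M) (rhsTerm₂ q 0 M))) ⟩
    sumSym N (λ j → rhsTerm₁ q 0 M j - rhsTerm₁ q 1 M j) + sumSym N (λ j → rhsTerm₂ q 1 M j - rhsTerm₂ q 0 M j)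
      ≡⟨ cong₂ _+_ (trans (sumSym-cong N (λ j → cong₂ _-_ (rhsTerm₁-0≡θ₀ M j) (rhsTerm₁-1≡θ₁ M j))) (sumSym-neg-even N θ))
                   (sumSym-cong N (λ j → cong₂ _-_ (rhsTerm₂-1≡θ₀ M j) (rhsTerm₂-0≡θ₁ M j))) ⟩
    sumSym N (λ j → θ (+ 2 ℤ.* j)) + sumSym N (λ j → θ (+ 2 ℤ.* j ℤ.- ℤ.1ℤ))
      ≡⟨ sym (sumSym-plus N _ _) ⟩
    sumSym N (λ j → θ (+ 2 ℤ.* j) + θ (+ 2 ℤ.* j ℤ.- ℤ.1ℤ))
      ≡⟨ sumSym-cong N (λ j → cong₂ _+_ (θ≡h (+ 2 ℤ.* j)) (θ≡h (+ 2 ℤ.* j ℤ.- ℤ.1ℤ))) ⟩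
    sumSym N (λ j → h (+ 2 ℤ.* j) + h (+ 2 ℤ.* j ℤ.- ℤ.1ℤ))
      ≡⟨ sumSym-interleave (signedθ-supported q 1ℚ (- 1ℚ) M) (ℕP.<⇒≤ M<N) (ℕP.n≤1+n M) ⟩
    sumSym (suc M) h ∎
    where
    open ≡-Reasoning
    regroup : ∀ a b c d → (a - b) - (c - d) ≡ (a - c) + (d - b)
    regroup = Solver.solve-∀ ℚ-ring
    unsign : ∀ a b → 1ℚ * (a + - 1ℚ * b) ≡ a - b
    unsign = Solver.solve-∀ ℚ-ring
    θ h : ℤ → ℚ
    θ t = θ₀ q M t - θ₁ q M t
    h = signedθ q 1ℚ (- 1ℚ) M
    θ≡h : ∀ t → θ t ≡ h t
    θ≡h t = sym (trans (cong (_* (θ₀ q M t + - 1ℚ * θ₁ q M t)) (1^ℤ t)) (unsign (θ₀ q M t) (θ₁ q M t)))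

-- The base q = 0

0^ℤ : ∀ z → z ≢ + 0 → 0ℚ ^ℤ z ≡ 0ℚ
0^ℤ (+ zero)  z≢0 = ⊥-elim (z≢0 refl)
0^ℤ (+ suc n) _   = *-zeroˡ (0ℚ ^ℕ n)
0^ℤ -[1+ n ]  _   = cong inv (*-zeroˡ (0ℚ ^ℕ n))

qbin-0 : ∀ n k → k ℕ.≤ n → qbin 0ℚ n k ≡ 1ℚ
qbin-0 n       zero    _           = refl
qbin-0 (suc n) (suc k) (ℕ.s≤s k≤n) =
  trans (cong₂ (λ u v → u + v * qbin 0ℚ n (suc k)) (qbin-0 n k k≤n) (*-zeroˡ (0ℚ ^ℕ k)))
        (trans (cong (λ u → 1ℚ + u) (*-zeroˡ (qbin 0ℚ n (suc k)))) (+-identityʳ 1ℚ))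

[2+k]*t≢±1 : ∀ k t c → + suc (suc k) ℤ.* t ≡ c → ℤ.∣ c ∣ ≢ 1
[2+k]*t≢±1 k t c [2+k]t≡c ∣c∣≡1
  with ℕP.m*n≡1⇒m≡1 (suc (suc k)) ℤ.∣ t ∣ (trans (sym (ℤP.abs-* (+ suc (suc k)) t)) (trans (cong ℤ.∣_∣ [2+k]t≡c) ∣c∣≡1))
... | ()

e₀≢0 : ∀ t → t ≢ + 0 → e₀ t ≢ + 0
e₀≢0 t t≢0 e₀≡0 with ℤP.i*j≡0⇒i≡0∨j≡0 t (trans (sym (factor t)) e₀≡0)
  where
  factor : ∀ t → + 6 ℤ.* t ℤ.* t ℤ.- t ≡ t ℤ.* (+ 6 ℤ.* t ℤ.- + 1)
  factor = ZS.solve-∀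
... | inj₁ t≡0      = t≢0 t≡0
... | inj₂ 6t-1≡0   = [2+k]*t≢±1 4 t (+ 1) (ℤP.i-j≡0⇒i≡j (+ 6 ℤ.* t) (+ 1) 6t-1≡0) refl

e₁≢0 : ∀ t → e₁ t ≢ + 0
e₁≢0 t e₁≡0 with ℤP.i*j≡0⇒i≡0∨j≡0 (+ 3 ℤ.* t ℤ.+ + 1) (trans (sym (factor t)) e₁≡0)
  where
  factor : ∀ t → + 6 ℤ.* t ℤ.* t ℤ.+ + 5 ℤ.* t ℤ.+ + 1 ≡ (+ 3 ℤ.* t ℤ.+ + 1) ℤ.* (+ 2 ℤ.* t ℤ.+ + 1)
  factor = ZS.solve-∀
... | inj₁ 3t+1≡0 = [2+k]*t≢±1 1 t -[1+ 0 ] (trans (shift (+ 3 ℤ.* t)) (cong (ℤ._- + 1) 3t+1≡0)) refl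
  where
  shift : ∀ x → x ≡ (x ℤ.+ + 1) ℤ.- + 1
  shift = ZS.solve-∀
... | inj₂ 2t+1≡0 = [2+k]*t≢±1 0 t -[1+ 0 ] (trans (shift (+ 2 ℤ.* t)) (cong (ℤ._- + 1) 2t+1≡0)) refl
  where
  shift : ∀ x → x ≡ (x ℤ.+ + 1) ℤ.- + 1
  shift = ZS.solve-∀

signedθ-0-supported : ∀ σ ε M → Supported 0 (signedθ 0ℚ σ ε M)
signedθ-0-supported σ ε M = supported (λ K → vanish (+ suc K) (λ ())) (λ K → vanish -[1+ K ] (λ ()))
  where
  vanish : ∀ t → t ≢ + 0 → signedθ 0ℚ σ ε M t ≡ 0ℚ
  vanish t t≢0 = trans (cong₂ (λ u v → σ ^ℤ t * (u * qbinℤ 0ℚ (2 ℕ.* M) (idx M (+ 0) t) + ε * (v * qbinℤ 0ℚ (2 ℕ.* M) (idx M (+ 1) t))))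
                              (0^ℤ (e₀ t) (e₀≢0 t t≢0)) (0^ℤ (e₁ t) (e₁≢0 t)))
                       (zeros (σ ^ℤ t) ε (qbinℤ 0ℚ (2 ℕ.* M) (idx M (+ 0) t)) (qbinℤ 0ℚ (2 ℕ.* M) (idx M (+ 1) t)))
    where
    zeros : ∀ s ε a b → s * (0ℚ * a + ε * (0ℚ * b)) ≡ 0ℚ
    zeros = Solver.solve-∀ ℚ-ring

sumSym-signedθ-0 : ∀ σ ε M → sumSym (suc M) (signedθ 0ℚ σ ε M) ≡ 1ℚ
sumSym-signedθ-0 σ ε M = begin
  sumSym (suc M) (signedθ 0ℚ σ ε M)
    ≡⟨ sumSym-stable (signedθ-0-supported σ ε M) (ℕ.z≤n {suc M}) (ℕ.z≤n {0}) ⟩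
  1ℚ * (1ℚ * qbin 0ℚ (2 ℕ.* M) (M ℕ.+ 0) + ε * ((0ℚ * 1ℚ) * X))
    ≡⟨ cong (λ u → 1ℚ * (1ℚ * u + ε * ((0ℚ * 1ℚ) * X))) (qbin-0 (2 ℕ.* M) (M ℕ.+ 0) M+0≤2M) ⟩
  1ℚ * (1ℚ * 1ℚ + ε * ((0ℚ * 1ℚ) * X))
    ≡⟨ value ε X ⟩
  1ℚ ∎
  where
  open ≡-Reasoning
  X = qbinℤ 0ℚ (2 ℕ.* M) (idx M (+ 1) (+ 0))
  M+0≤2M : M ℕ.+ 0 ℕ.≤ 2 ℕ.* M
  M+0≤2M = ℕP.≤-trans (ℕP.≤-reflexive (ℕP.+-identityʳ M)) (ℕP.m≤n*m M 2)
  value : ∀ ε X → 1ℚ * (1ℚ * 1ℚ + ε * ((0ℚ * 1ℚ) * X)) ≡ 1ℚ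
  value = Solver.solve-∀ ℚ-ring

F-at-1-0 : ∀ (0-nru : NonRootOfUnity (0ℚ * 0ℚ)) M → LeftSide.F 0ℚ 0-nru M 1ℚ ≡ 1ℚ
F-at-1-0 0-nru zero    = refl
F-at-1-0 0-nru (suc M) = begin
  F (suc M) 1ℚ                                          ≡⟨ F-step M 1ℚ ⟩
  F M 1ℚ + (1ℚ + 1ℚ) * 0ℚ ^ℕ suc M * F M (1ℚ * 0ℚ)      ≡⟨ cong₂ (λ u v → u + (1ℚ + 1ℚ) * v * F M (1ℚ * 0ℚ)) (F-at-1-0 0-nru M) (*-zeroˡ (0ℚ ^ℕ M)) ⟩
  1ℚ + (1ℚ + 1ℚ) * 0ℚ * F M (1ℚ * 0ℚ)                   ≡⟨ vanish (F M (1ℚ * 0ℚ)) ⟩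
  1ℚ                                                    ∎
  where
  open ≡-Reasoning
  open LeftSide 0ℚ 0-nru
  vanish : ∀ b → 1ℚ + (1ℚ + 1ℚ) * 0ℚ * b ≡ 1ℚ
  vanish = Solver.solve-∀ ℚ-ring

F-at-1≡sumSym : ∀ q → NonRootOfUnity q → (q²-nru : NonRootOfUnity (q * q)) → ∀ M →
                LeftSide.F q q²-nru M 1ℚ ≡ sumSym (suc M) (signedθ q (- 1ℚ) 1ℚ M)
F-at-1≡sumSym q q-nru q²-nru M with q ≟ 0ℚ
... | yes refl = trans (F-at-1-0 q²-nru M) (sym (sumSym-signedθ-0 (- 1ℚ) 1ℚ M))
... | no q≢0   = proj₁ (Comparison.F≡ΣA×F≡ΣZ q q≢0 q-nru q²-nru M)

sumSym-signedθ≡1 : ∀ q → NonRootOfUnity q → NonRootOfUnity (q * q) → ∀ M →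
                   sumSym (suc M) (signedθ q 1ℚ (- 1ℚ) M) ≡ 1ℚ
sumSym-signedθ≡1 q q-nru q²-nru M with q ≟ 0ℚ
... | yes refl = sumSym-signedθ-0 1ℚ (- 1ℚ) M
... | no q≢0   = Comparison.ΣA≡1 q q≢0 q-nru q²-nru M

sum-and-difference : ∀ {x y u v} → x + y ≡ u + v → x - y ≡ u - v → (x ≡ u) × (y ≡ v)
sum-and-difference {x} {y} {u} {v} x+y≡u+v x-y≡u-v =
  *-cancelʳ-≢0 x u 2ℚ (λ ()) (trans (twice₁ x y) (trans (cong₂ _+_ x+y≡u+v x-y≡u-v) (sym (twice₁ u v)))) ,
  *-cancelʳ-≢0 y v 2ℚ (λ ()) (trans (twice₂ x y) (trans (cong₂ _-_ x+y≡u+v x-y≡u-v) (sym (twice₂ u v))))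
  where
  2ℚ = 1ℚ + 1ℚ
  twice₁ : ∀ x y → x * (1ℚ + 1ℚ) ≡ (x + y) + (x - y)
  twice₁ = Solver.solve-∀ ℚ-ring
  twice₂ : ∀ x y → y * (1ℚ + 1ℚ) ≡ (x + y) - (x - y)
  twice₂ = Solver.solve-∀ ℚ-ring

mainTheorem12 : (a : ℕ) → a ℕ.≤ 1 → (M : ℕ) → (q : ℚ) → q ≢ 1ℚ → q ≢ - 1ℚ →
    ∃[ N₀ ] ((N : ℕ) → N₀ ℕ.≤ N →
      sumBelow N (lhsTerm q a M)
        ≡ sumSym N (rhsTerm₁ q a M) - sumSym N (rhsTerm₂ q a M))
mainTheorem12 a a≤1 M q q≢1 q≢-1 = suc M , λ N M<N →
  select {N} a a≤1 (sum-and-difference (sums N M<N) (differences N M<N))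
  where
  q-nru = ≢±1⇒nonRootOfUnity q q≢1 q≢-1
  q²-nru = nonRootOfUnity-square q q-nru
  open LeftSide q q²-nru using (F-at-−1)
  open LeftSideOfTheorem q q-nru q²-nru using (lhs-plus; lhs-minus)
  open RightSideOfTheorem q q-nru using (rhs; rhs-plus; rhs-minus)
  lhs : ℕ → ℕ → ℚ
  lhs a N = sumBelow N (lhsTerm q a M)
  sums : ∀ N → M ℕ.< N → lhs 0 N + lhs 1 N ≡ rhs 0 M N + rhs 1 M N
  sums N M<N = trans (lhs-plus M N M<N) (trans (F-at-1≡sumSym q q-nru q²-nru M) (sym (rhs-plus M N M<N)))
  differences : ∀ N → M ℕ.< N → lhs 0 N - lhs 1 N ≡ rhs 0 M N - rhs 1 M N
  differences N M<N = trans (lhs-minus M N M<N)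
    (trans (F-at-−1 M) (trans (sym (sumSym-signedθ≡1 q q-nru q²-nru M)) (sym (rhs-minus M N M<N))))
  select : ∀ {N} a → a ℕ.≤ 1 → (lhs 0 N ≡ rhs 0 M N) × (lhs 1 N ≡ rhs 1 M N) → lhs a N ≡ rhs a M N
  select zero          _            (eq₀ , _)   = eq₀
  select (suc zero)    _            (_   , eq₁) = eq₁
  select (suc (suc a)) (ℕ.s≤s ())
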